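{- Let $e\ge 3$ be an odd integer with $e\equiv 1 \pmod 4$, let $q=2^e$, and let $\mathcal{C}^3_\varepsilon:=\mathcal{C}(\mathcal{V}^3_\varepsilon)$ be the projective code over $\mathbb{F}_{q^2}$ generated by the point set $\mathcal{V}^3_\varepsilon\subset\mathrm{PG}(3,q^2)$ (defined in the context, with $r=3$). Then the weights of the non-zero codewords of $\mathcal{C}^3_\varepsilon$ belong to the set $$\{q^5,\ q^5-q^3,\ q^5-q^3+q^2,\ q^5-q^3+q,\ q^5-q^3+q^2+q\}.$$
   Context: Let $e\ge 3$ be odd, $q=2^e$, $r\ge 2$. Points of $\mathrm{PG}(r,q^2)$ (projective space of projective dimension $r$ over $\mathbb{F}_{q^2}$) have homogeneous coordinates $(X_0,\dots,X_r)$; $\Pi_\infty$ is the hyperplane $X_0=0$, and affine coordinates on the complement $\mathrm{AG}(r,q^2)$ are $x_i=X_i/X_0$. For an exponent involving $\sigma$, $\sigma$ stands for $2^{(e+1)/2}$, i.e. $x^{\sigma}=x^{2^{(e+1)/2}}$ and $x^{\sigma+2}=x^{2^{(e+1)/2}+2}$. Fix $\varepsilon\in\mathbb{F}_{q^2}\setminus\mathbb{F}_q$ such that $\varepsilon^2+\varepsilon+\delta=0$ for some $\delta\in\mathbb{F}_q\setminus\{1\}$ with absolute trace $\mathrm{Tr}_{q/2}(\delta)=\sum_{i=0}^{e-1}\delta^{2^i}=1$. Put $$\Gamma_{\varepsilon}(x)=[x+(x^q+x)\varepsilon]^{\sigma+2}+(x^q+x)^{\sigma}+(x^{2q}+x^2)\varepsilon+x^{q+1}+x^2.$$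 $\mathcal{V}^r_\varepsilon$ is the projective hypersurface of $\mathrm{PG}(r,q^2)$ with affine equation $x_r^q+x_r=\Gamma_{\varepsilon}(x_1)+\dots+\Gamma_{\varepsilon}(x_{r-1})$, i.e. the zero locus of the homogenization (with respect to $X_0$) of the corresponding polynomial; it is identified with its set of $\mathbb{F}_{q^2}$-rational points. For a set $\Omega$ of $N$ points of $\mathrm{PG}(r,q^2)$, $\mathcal{C}(\Omega)$ is the linear code of length $N$ over $\mathbb{F}_{q^2}$ spanned by the rows of an $(r+1)\times N$ matrix whose columns are coordinate vectors of the points of $\Omega$ (one representative per point); it is unique up to monomial equivalence. The weight of a codeword is its Hamming weight. -}

module Defs where

open import Level using (_⊔_) renaming (suc to lsuc)
open import Algebra.Bundles using (CommutativeRing; RawRing; Semiring)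
import Algebra.Definitions.RawSemiring as RawSemiringDefs
open import Data.Bool.Base using (if_then_else_)
open import Data.Fin.Base using (Fin; toℕ; fromℕ; inject₁)
import Data.Fin.Properties as Fin
open import Data.List.Base as List using (List; []; _∷_; _++_; [_]; filter; cartesianProductWith)
open import Data.Nat.Base as ℕ using (ℕ; suc; _∸_)
open import Data.Nat.DivMod using (_/_)
import Data.Nat.Properties as ℕ
open import Data.Product.Base using (Σ; ∃; _×_; _,_; proj₁; proj₂)
open import Data.Vec.Base as Vec using (Vec)
open import Data.Vec.Functional using (Vector)
open import Data.Vec.Properties using (≡-dec)
open import Function.Bundles using (Inverse)
open import Function.Properties.Inverse using (Inverse⇒Injection)
open import Relation.Binary.Definitions using (Decidable)
open import Relation.Binary.PropositionalEquality as ≡ using (_≡_)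
open import Relation.Nullary using (¬_; does; ¬?)
open import Relation.Nullary.Decidable using (via-injection)
open import Relation.Unary using (Pred)

record FiniteField c ℓ (order : ℕ) : Set (lsuc (c ⊔ ℓ)) where
  field
    commutativeRing : CommutativeRing c ℓ
  open CommutativeRing commutativeRing public
  field
    1≉0         : 1# ≉ 0#
    inverse     : ∀ x → x ≉ 0# → ∃ λ y → x * y ≈ 1#
    enumeration : Inverse setoid (≡.setoid (Fin order))

  _≟_ : Decidable _≈_
  _≟_ = via-injection (Inverse⇒Injection enumeration) Fin._≟_

σ : ℕ → ℕ
σ e = 2 ℕ.^ ((e ℕ.+ 1) / 2)

-- Stated over an arbitrary ring so that it can be applied to polynomials.
Γ : ∀ {c ℓ} (A : RawRing c ℓ) (e : ℕ) (ε x : RawRing.Carrier A) → RawRing.Carrier A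
Γ A e ε x =
    (x + (x ^ q + x) * ε) ^ (σ e ℕ.+ 2) + (x ^ q + x) ^ σ e
    + (x ^ (2 ℕ.* q) + x ^ 2) * ε + x ^ (q ℕ.+ 1) + x ^ 2
  where
  open RawRing A
  open RawSemiringDefs rawSemiring using (_^_)
  q = 2 ℕ.^ e

module OverField {c ℓ n} (F : FiniteField c ℓ n) where

  open FiniteField F
  open RawSemiringDefs (Semiring.rawSemiring semiring) using (_^_; sum; product)

  -- In a field of order q², the subfield of order q is the fixed set of x ↦ x ^ q.
  _∈GF_ : Carrier → ℕ → Set ℓ
  x ∈GF q = x ^ q ≈ x

  absoluteTrace : ℕ → Carrier → Carrier
  absoluteTrace e x = sum {e} (λ i → x ^ (2 ℕ.^ toℕ i))

  record Admissible (e : ℕ) (ε δ : Carrier) : Set ℓ where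
    field
      ε∉GF[q] : ¬ (ε ∈GF (2 ℕ.^ e))
      δ∈GF[q] : δ ∈GF (2 ℕ.^ e)
      δ≉1     : δ ≉ 1#
      trace-δ : absoluteTrace e δ ≈ 1#
      root    : ε ^ 2 + ε + δ ≈ 0#

  -- A polynomial in k variables is a formal sum of terms a·X^α.  The same α
  -- may occur several times; its coefficient is the sum of all occurrences.
  Poly : ℕ → Set c
  Poly k = List (Carrier × Vec ℕ k)

  coeff : ∀ {k} → Poly k → Vec ℕ k → Carrier
  coeff []            α = 0#
  coeff ((a , β) ∷ f) α = (if does (≡-dec ℕ._≟_ β α) then a else 0#) + coeff f α

  polyRing : ℕ → RawRing c ℓ
  polyRing k = record
    { Carrier = Poly k
    ; _≈_     = λ f g → ∀ α → coeff f α ≈ coeff g α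
    ; _+_     = _++_
    ; _*_     = cartesianProductWith λ (a , α) (b , β) → a * b , Vec.zipWith ℕ._+_ α β
    ; -_      = List.map λ (a , α) → - a , α
    ; 0#      = []
    ; 1#      = [ 1# , Vec.replicate k 0 ]
    }

  const : ∀ {k} → Carrier → Poly k
  const a = [ a , Vec.replicate _ 0 ]

  var : ∀ {k} → Fin k → Poly k
  var i = [ 1# , Vec.updateAt (Vec.replicate _ 0) i (λ _ → 1) ]

  eval : ∀ {k} → Poly k → Vector Carrier k → Carrier
  eval f v = List.foldr (λ (a , α) s → a * product (λ i → v i ^ Vec.lookup α i) + s) 0# f

  -- The total degree, with degree 0 for the zero polynomial; terms whose
  -- coefficient cancels do not count.
  degree : ∀ {k} → Poly k → ℕ
  degree f = List.foldr ℕ._⊔_ 0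
    (List.map Vec.sum (filter (λ α → ¬? (coeff f α ≟ 0#)) (List.map proj₂ f)))

  -- The new variable X₀ comes first.  Truncated subtraction only truncates
  -- on terms of degree > degree f, all of which cancel.
  homogenize : ∀ {k} → Poly k → Poly (suc k)
  homogenize f = List.map (λ (a , α) → a , (degree f ∸ Vec.sum α) Vec.∷ α) f

  Point : ℕ → Set (c ⊔ ℓ)
  Point r = Σ (Vector Carrier (suc r)) λ X → ∃ λ i → X i ≉ 0#

  -- Representatives of the same point of PG(r, F).
  _∼_ : ∀ {r} → Point r → Point r → Set (c ⊔ ℓ)
  (X , _) ∼ (Y , _) = ∃ λ a → a ≉ 0# × (∀ i → X i ≈ a * Y i)

  -- With r = m + 1, the affine coordinates x₁ , … , xᵣ are numbered 0 , … , m.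
  affineEquation : ∀ {m} → ℕ → Carrier → Poly (suc m)
  affineEquation {m} e ε =
      xᵣ P.^ (2 ℕ.^ e) R.+ xᵣ
      R.+ R.- P.sum (λ (i : Fin m) → Γ (polyRing (suc m)) e (const ε) (var (inject₁ i)))
    where
    module R = RawRing (polyRing (suc m))
    module P = RawSemiringDefs R.rawSemiring
    xᵣ = var (fromℕ m)

  𝒱 : ∀ {m} → ℕ → Carrier → Pred (Point (suc m)) ℓ
  𝒱 e ε (X , _) = eval (homogenize (affineEquation e ε)) X ≈ 0#

  -- P lists exactly one representative of each point of Ω.
  record Enumerates {r N p} (P : Fin N → Point r) (Ω : Pred (Point r) p) : Set (c ⊔ ℓ ⊔ p) where
    field
      sound    : ∀ j → Ω (P j)
      distinct : ∀ i j → P i ∼ P j → i ≡ j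
      complete : ∀ x → Ω x → ∃ λ j → x ∼ P j

  generatorMatrix : ∀ {r N} → (Fin N → Point r) → Fin (suc r) → Vector Carrier N
  generatorMatrix P i j = proj₁ (P j) i

  RowSpan : ∀ {k N} → (Fin k → Vector Carrier N) → Pred (Vector Carrier N) (c ⊔ ℓ)
  RowSpan {k} G w = ∃ λ (a : Vector Carrier k) → ∀ j → w j ≈ sum (λ i → a i * G i j)

  𝒞 : ∀ {r N} → (Fin N → Point r) → Pred (Vector Carrier N) (c ⊔ ℓ)
  𝒞 P = RowSpan (generatorMatrix P)

  NonZeroWord : ∀ {N} → Vector Carrier N → Set ℓ
  NonZeroWord w = ¬ (∀ j → w j ≈ 0#)

  weight : ∀ {N} → Vector Carrier N → ℕ
  weight {N} w = Vec.count (λ j → ¬? (w j ≟ 0#)) (Vec.allFin N)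

{-# OPTIONS --safe #-}

-- Write q = 2^e, K = GF(q) and x = s + t ε with s, t ∈ K. Since ε^q = ε + 1, the form Γ becomes
-- s^(σ+2) + s t + t^σ, whose zero set is the Suzuki–Tits ovoid: over K it takes the value 0 once and
-- every other value q + 1 times, and this persists, with another exceptional value, after adding
-- a K-linear functional, because translations of the Suzuki group absorb the functional.
-- Hence a plane avoiding (0 : 0 : 0 : 1) meets the affine part of 𝒱 in q³ + q² − q or q³ − q points,
-- according to whether two exceptional values add up to a given constant; the other affine planes
-- are unions of parallel lines with q points of 𝒱 each. At infinity 𝒱 is the line X₀ = 0, X₁ = X₂,
-- because x ↦ x^(σ+2) is injective on F for e ≡ 1 mod 4. The weight of a word is
-- |𝒱| = q⁵ + q² + 1 minus the size of the corresponding plane section.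
module Submission where

open import Defs
open import Level using (_⊔_)
open import Algebra.Bundles using (CommutativeRing; RawRing; Semiring)
import Algebra.Definitions.RawSemiring as RawSemiringDefs
import Algebra.Properties.CommutativeMonoid.Sum as Sum
import Algebra.Properties.CommutativeSemigroup as CommutativeSemigroup
import Algebra.Properties.CommutativeSemiring.Exp as Exp
import Algebra.Properties.Ring as RingProperties
import Algebra.Properties.Semiring.Mult as SemiringMult
import Algebra.Solver.Ring as RingSolver
open import Algebra.Solver.Ring.AlmostCommutativeRing using (_-Raw-AlmostCommutative⟶_; fromCommutativeRing)
open import Data.Bool.Base using (Bool; true; false; if_then_else_)
open import Data.Bool.Properties using (xor-∧-commutativeRing)
open import Data.Empty using (⊥-elim)
open import Data.Fin.Base using (Fin; zero; suc; toℕ)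
open import Data.Fin.Patterns using (0F; 1F; 2F; 3F)
open import Data.Fin.Properties as Fin using (injective⇒≤; +↔⊎; *↔×)
open import Data.List.Base as List using (List; []; _∷_; _++_)
open import Data.List.Membership.Propositional using (_∈_)
open import Data.List.Membership.Propositional.Properties using (∈-filter⁺; ∈-map⁺)
open import Data.List.Relation.Unary.All as All using (All; []; _∷_)
import Data.List.Relation.Unary.All.Properties as All
open import Data.List.Relation.Unary.Any using (here; there)
open import Data.Maybe.Base using (Maybe; just; nothing)
open import Data.Nat.Base as ℕ using (ℕ; zero; suc; _∸_)
open import Data.Nat.DivMod using (_/_; m*n/n≡m; m≡m%n+[m/n]*n)
import Data.Nat.Properties as ℕ
import Data.Nat.Solver as ℕ
open import Data.Product.Base using (∃; _×_; _,_; proj₁; proj₂)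
open import Data.Product.Relation.Binary.Pointwise.NonDependent using (×-setoid)
open import Data.Sum.Base using (_⊎_; inj₁; inj₂)
open import Data.Unit.Base using (⊤; tt)
open import Data.Vec.Base as Vec using (Vec; []; _∷_)
open import Data.Vec.Functional using (Vector)
import Data.Vec.Properties as Vec
open import Function.Base using (_∘_; id; case_of_)
open import Function.Bundles using (Inverse; _↔_; mk↔ₛ′)
open import Relation.Binary.Bundles using (Setoid)
open import Relation.Binary.Definitions using (tri<; tri≈; tri>)
open import Relation.Binary.PropositionalEquality as ≡ using (_≡_)
import Relation.Binary.Reasoning.Setoid as SetoidReasoning
open import Relation.Nullary using (¬_; Dec; yes; no; ¬?; does)
open import Relation.Unary using (Pred; Decidable; U)

-- The fibre sizes rest on the Tits endomorphism: with e = 2k + 1 the map φ : x ↦ x^σ satisfies φ² =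
-- squaring on K. Hence (s, t) ↦ (c s, c φ(c) t) multiplies the Suzuki form by c^(σ+2), and c ↦
-- c^(σ+2) maps K* onto itself, so all q - 1 nonzero values have fibres of one common size m. The
-- value 0 is taken only at the origin: a zero with s ≠ 0 rescales to s = 1, and then φ t = t + 1,
-- which is impossible in K. So (q - 1) m = q² - 1 and m = q + 1. Two features of the setting shape
-- the rest. F is known only as a commutative ring with inverses and an enumeration, so
-- characteristic 2, x^(q²) = x and |K| = q are all obtained by counting or by permuting F. And
-- `degree` in the definition of 𝒱 ignores the cancelling terms of a polynomial with symbolic
-- exponents; it is pinned down indirectly, by homogenizing to the explicit degree (σ + 2) q and
-- testing one coefficient through evaluation at (0 : 1 : 0 : 0).

-- Counting subsets of a setoid.

record HasSize {c ℓ p} (S : Setoid c ℓ) (Ω : Pred (Setoid.Carrier S) p) (n : ℕ) : Set (c ⊔ ℓ ⊔ p) where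
  open Setoid S using (_≈_)
  field
    elem     : Fin n → Setoid.Carrier S
    sound    : ∀ i → Ω (elem i)
    distinct : ∀ i j → elem i ≈ elem j → i ≡ j
    complete : ∀ x → Ω x → ∃ λ i → x ≈ elem i

hasSize-↔ : ∀ {i c ℓ p} {I : Set i} {n} (S : Setoid c ℓ) {Ω : Pred (Setoid.Carrier S) p} → Fin n ↔ I →
            let open Setoid S using (_≈_) in
            (elem : I → Setoid.Carrier S) → (∀ i → Ω (elem i)) → (∀ i j → elem i ≈ elem j → i ≡ j) →
            (∀ x → Ω x → ∃ λ i → x ≈ elem i) → HasSize S Ω n
hasSize-↔ S n↔I elem sound distinct complete = record
  { elem     = elem ∘ to
  ; sound    = sound ∘ to
  ; distinct = λ i j eq → ≡.trans (≡.sym (strictlyInverseʳ i))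
      (≡.trans (≡.cong from (distinct _ _ eq)) (strictlyInverseʳ j))
  ; complete = λ x x∈Ω → let i , eq = complete x x∈Ω in
      from i , trans eq (reflexive (≡.cong elem (≡.sym (strictlyInverseˡ i))))
  }
  where
  open Inverse n↔I
  open Setoid S using (trans; reflexive)

module _ {c ℓ} (S : Setoid c ℓ) where
  open Setoid S renaming (Carrier to A)

  hasSize-≤ : ∀ {p n k} {Ω : Pred A p} → HasSize S Ω n → HasSize S Ω k → n ℕ.≤ k
  hasSize-≤ N K = injective⇒≤ {f = λ i → proj₁ (K.complete _ (N.sound i))} λ {i} {j} eq →
    N.distinct i j (trans (proj₂ (K.complete _ (N.sound i)))
      (trans (reflexive (≡.cong K.elem eq)) (sym (proj₂ (K.complete _ (N.sound j))))))
    where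
    module N = HasSize N
    module K = HasSize K

  hasSize-unique : ∀ {p n k} {Ω : Pred A p} → HasSize S Ω n → HasSize S Ω k → n ≡ k
  hasSize-unique N K = ℕ.≤-antisym (hasSize-≤ N K) (hasSize-≤ K N)

  hasSize-⇔ : ∀ {p r n} {Ω : Pred A p} {Ψ : Pred A r} →
              (∀ x → Ω x → Ψ x) → (∀ x → Ψ x → Ω x) → HasSize S Ω n → HasSize S Ψ n
  hasSize-⇔ Ω⊆Ψ Ψ⊆Ω N = record
    { elem     = elem
    ; sound    = λ i → Ω⊆Ψ _ (sound i)
    ; distinct = distinct
    ; complete = λ x x∈Ψ → complete x (Ψ⊆Ω x x∈Ψ)
    }
    where open HasSize N

  hasSize-∅ : ∀ {p} {Ω : Pred A p} → (∀ x → ¬ Ω x) → HasSize S Ω 0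
  hasSize-∅ empty = record
    { elem     = λ ()
    ; sound    = λ ()
    ; distinct = λ ()
    ; complete = λ x x∈Ω → ⊥-elim (empty x x∈Ω)
    }

  hasSize-1 : ∀ {p} {Ω : Pred A p} (x : A) → Ω x → (∀ y → Ω y → y ≈ x) → HasSize S Ω 1
  hasSize-1 x x∈Ω unique = record
    { elem     = λ _ → x
    ; sound    = λ _ → x∈Ω
    ; distinct = λ { zero zero _ → ≡.refl }
    ; complete = λ y y∈Ω → zero , unique y y∈Ω
    }

  hasSize-∪ : ∀ {p r n k} {Ω : Pred A p} {Ψ : Pred A r} →
              (∀ x y → Ω x → Ψ y → ¬ x ≈ y) →
              HasSize S Ω n → HasSize S Ψ k → HasSize S (λ x → Ω x ⊎ Ψ x) (n ℕ.+ k)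
  hasSize-∪ {n = n} {k} disjoint N K = hasSize-↔ S +↔⊎ elem sound distinct complete
    where
    module N = HasSize N
    module K = HasSize K
    elem : Fin n ⊎ Fin k → A
    elem (inj₁ i) = N.elem i
    elem (inj₂ i) = K.elem i
    sound : ∀ i → _
    sound (inj₁ i) = inj₁ (N.sound i)
    sound (inj₂ i) = inj₂ (K.sound i)
    distinct : ∀ i j → elem i ≈ elem j → i ≡ j
    distinct (inj₁ i) (inj₁ j) eq = ≡.cong inj₁ (N.distinct i j eq)
    distinct (inj₁ i) (inj₂ j) eq = ⊥-elim (disjoint _ _ (N.sound i) (K.sound j) eq)
    distinct (inj₂ i) (inj₁ j) eq = ⊥-elim (disjoint _ _ (N.sound j) (K.sound i) (sym eq))
    distinct (inj₂ i) (inj₂ j) eq = ≡.cong inj₂ (K.distinct i j eq)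
    complete : ∀ x → _ → ∃ λ i → x ≈ elem i
    complete x (inj₁ x∈Ω) = let i , eq = N.complete x x∈Ω in inj₁ i , eq
    complete x (inj₂ x∈Ψ) = let i , eq = K.complete x x∈Ψ in inj₂ i , eq

count-map : ∀ {a b p n} {A : Set a} {B : Set b} {P : Pred B p} (P? : Decidable P) (f : A → B) (xs : Vec.Vec A n) →
            Vec.count P? (Vec.map f xs) ≡ Vec.count (P? ∘ f) xs
count-map P? f Vec.[]       = ≡.refl
count-map P? f (x Vec.∷ xs) = ≡.cong (if does (P? (f x)) then suc else id) (count-map P? f xs)

-- Connects the `Vec.count` in the definition of `weight` with counting by enumeration.
hasSize-count : ∀ {p n} {P : Pred (Fin n) p} (P? : Decidable P) →
                HasSize (≡.setoid (Fin n)) P (Vec.count P? (Vec.allFin n))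
hasSize-count {n = zero}  P? = hasSize-∅ (≡.setoid _) λ ()
hasSize-count {n = suc n} {P} P? =
  ≡.subst (HasSize Fin-setoid P) (≡.cong (if does (P? zero) then suc else id) tail-count) (extend (P? zero))
  where
  Fin-setoid = ≡.setoid (Fin (suc n))
  k = Vec.count (P? ∘ suc) (Vec.allFin n)
  tail-count : k ≡ Vec.count P? (Vec.tabulate suc)
  tail-count = ≡.sym (≡.trans (≡.cong (Vec.count P?) (Vec.tabulate-allFin suc)) (count-map P? suc (Vec.allFin n)))
  module R = HasSize (hasSize-count (P? ∘ suc))
  sucs : HasSize Fin-setoid (λ i → ∃ λ j → i ≡ suc j × P (suc j)) k
  sucs = record
    { elem     = suc ∘ R.elem
    ; sound    = λ i → R.elem i , ≡.refl , R.sound i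
    ; distinct = λ i j eq → R.distinct i j (Fin.suc-injective eq)
    ; complete = λ { _ (j , ≡.refl , Pj) → let i , eq = R.complete j Pj in i , ≡.cong suc eq }
    }
  extend : (d : Dec (P zero)) → HasSize Fin-setoid P ((if does d then suc else id) k)
  extend (yes P0) = hasSize-⇔ Fin-setoid
    (λ { _ (inj₁ ≡.refl) → P0 ; _ (inj₂ (_ , ≡.refl , Pj)) → Pj })
    (λ { zero _ → inj₁ ≡.refl ; (suc j) Pj → inj₂ (j , ≡.refl , Pj) })
    (hasSize-∪ Fin-setoid (λ { _ _ ≡.refl (_ , ≡.refl , _) () })
      (hasSize-1 Fin-setoid {Ω = _≡ zero} zero ≡.refl (λ _ eq → eq)) sucs)
  extend (no ¬P0) = hasSize-⇔ Fin-setoid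
    (λ { _ (_ , ≡.refl , Pj) → Pj })
    (λ { zero P0 → ⊥-elim (¬P0 P0) ; (suc j) Pj → j , ≡.refl , Pj })
    sucs

module _ {c ℓ d m} (S : Setoid c ℓ) (T : Setoid d m) where
  private
    module S = Setoid S
    module T = Setoid T

  hasSize-map : ∀ {p r n} {Ω : Pred S.Carrier p} {Ψ : Pred T.Carrier r} (f : S.Carrier → T.Carrier) →
                (∀ {x y} → x S.≈ y → f x T.≈ f y) →
                (∀ x → Ω x → Ψ (f x)) →
                (∀ x y → Ω x → Ω y → f x T.≈ f y → x S.≈ y) →
                (∀ y → Ψ y → ∃ λ x → Ω x × y T.≈ f x) →
                HasSize S Ω n → HasSize T Ψ n
  hasSize-map f cong f-sound f-injective f-surjective N = record
    { elem     = f ∘ elem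
    ; sound    = λ i → f-sound _ (sound i)
    ; distinct = λ i j eq → distinct i j (f-injective _ _ (sound i) (sound j) eq)
    ; complete = λ y y∈Ψ → let x , x∈Ω , y≈fx = f-surjective y y∈Ψ ; i , x≈ = complete x x∈Ω in
        i , T.trans y≈fx (cong x≈)
    }
    where open HasSize N

  hasSize-image : ∀ {p n} {Ω : Pred S.Carrier p} (f : S.Carrier → T.Carrier) →
                  (∀ {x y} → x S.≈ y → f x T.≈ f y) → (∀ x y → f x T.≈ f y → x S.≈ y) →
                  HasSize S Ω n → HasSize T (λ y → ∃ λ x → Ω x × y T.≈ f x) n
  hasSize-image f cong injective = hasSize-map f cong (λ x x∈Ω → x , x∈Ω , T.refl) (λ x y _ _ → injective x y) (λ _ y∈ → y∈)

  -- All fibres must have the same size k. The first argument moves an element of the fibre over x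
  -- to the fibre over the listed representative of x.
  hasSize-Σ : ∀ {p r n k} {Ω : Pred S.Carrier p} {Ψ : S.Carrier → Pred T.Carrier r} →
              (∀ {x x′} y → x S.≈ x′ → Ψ x y → Ψ x′ y) →
              HasSize S Ω n → (∀ x → Ω x → HasSize T (Ψ x) k) →
              HasSize (×-setoid S T) (λ (x , y) → Ω x × Ψ x y) (n ℕ.* k)
  hasSize-Σ {n = n} {k} {Ω} {Ψ} resp N K = hasSize-↔ (×-setoid S T) *↔×
    (λ (i , j) → N.elem i , K.elem i j)
    (λ (i , j) → N.sound i , K.sound i j)
    distinct
    (λ (x , y) (x∈Ω , y∈Ψ) → let i , x≈ = N.complete x x∈Ω ; j , y≈ = K.complete i y (resp y x≈ y∈Ψ) in
      (i , j) , x≈ , y≈)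
    where
    module N = HasSize N
    module K i = HasSize (K (N.elem i) (N.sound i))
    distinct : ∀ (i j : Fin n × Fin k) → N.elem (proj₁ i) S.≈ N.elem (proj₁ j) ×
               K.elem (proj₁ i) (proj₂ i) T.≈ K.elem (proj₁ j) (proj₂ j) → i ≡ j
    distinct (i , i′) (j , j′) (eq , eq′) with N.distinct i j eq
    ... | ≡.refl = ≡.cong (i ,_) (K.distinct i i′ j′ eq′)

module _ {c ℓ} (S : Setoid c ℓ) where
  open Setoid S renaming (Carrier to A)

  -- Gives only the existence of a size. Unknown cardinalities, such as that of K or of one fibre of
  -- the Suzuki form, enter this way and are determined afterwards by `hasSize-unique`.
  hasSize-filter : ∀ {p r n} {Ω : Pred A p} {P : Pred A r} → (∀ {x y} → x ≈ y → P x → P y) →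
                   Decidable P → HasSize S Ω n → ∃ λ k → HasSize S (λ x → Ω x × P x) k
  hasSize-filter resp P? N = _ , hasSize-map (≡.setoid _) S elem (λ { ≡.refl → refl })
    (λ i Pi → sound i , Pi) (λ i j _ _ eq → distinct i j eq)
    (λ x (x∈Ω , Px) → let i , eq = complete x x∈Ω in i , resp eq Px , eq)
    (hasSize-count (P? ∘ elem))
    where open HasSize N

  -- The complement has some size l by filtering, and splitting Ω gives k + l = n; this makes the
  -- truncated n ∸ k an honest difference.
  hasSize-∖ : ∀ {p r n k} {Ω : Pred A p} {P : Pred A r} → (∀ {x y} → x ≈ y → P x → P y) →
              Decidable P → HasSize S Ω n → HasSize S (λ x → Ω x × P x) k →
              HasSize S (λ x → Ω x × ¬ P x) (n ℕ.∸ k)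
  hasSize-∖ {n = n} {k} {Ω} {P} resp P? N K = ≡.subst (HasSize S _)
    (≡.trans (≡.sym (ℕ.m+n∸m≡n k l)) (≡.cong (ℕ._∸ k) (hasSize-unique S whole N))) L
    where
    filtered = hasSize-filter (λ x≈y ¬Px Py → ¬Px (resp (sym x≈y) Py)) (λ x → ¬? (P? x)) N
    l = proj₁ filtered
    L = proj₂ filtered
    whole : HasSize S Ω (k ℕ.+ l)
    whole = hasSize-⇔ S (λ { x (inj₁ (x∈Ω , _)) → x∈Ω ; x (inj₂ (x∈Ω , _)) → x∈Ω })
      (λ x x∈Ω → case P? x of λ { (yes Px) → inj₁ (x∈Ω , Px) ; (no ¬Px) → inj₂ (x∈Ω , ¬Px) })
      (hasSize-∪ S (λ x y (_ , Px) (_ , ¬Py) x≈y → ¬Py (resp x≈y Px)) K L)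

-- Finite fields: the characteristic and x^n = x.

module FiniteFieldProperties {c ℓ n} (F : FiniteField c ℓ n) where

  open FiniteField F hiding (zero) renaming (_≟_ to infix 4 _≟_)
  open Exp commutativeSemiring
  open SemiringMult semiring using (×1-homo-*) renaming (_×_ to _×ₙ_)
  open SetoidReasoning setoid
  private
    module E = Inverse enumeration
    module + = Sum +-commutativeMonoid
    module * = Sum *-commutativeMonoid

  *-cancelˡ-nonzero : ∀ {x y z} → x ≉ 0# → x * y ≈ x * z → y ≈ z
  *-cancelˡ-nonzero {x} {y} {z} x≉0 xy≈xz = begin
    y              ≈⟨ *-identityˡ y ⟨
    1# * y         ≈⟨ *-congʳ x⁻¹x≈1 ⟨
    x⁻¹ * x * y    ≈⟨ *-assoc x⁻¹ x y ⟩
    x⁻¹ * (x * y)  ≈⟨ *-congˡ xy≈xz ⟩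
    x⁻¹ * (x * z)  ≈⟨ *-assoc x⁻¹ x z ⟨
    x⁻¹ * x * z    ≈⟨ *-congʳ x⁻¹x≈1 ⟩
    1# * z         ≈⟨ *-identityˡ z ⟩
    z              ∎
    where
    x⁻¹ = proj₁ (inverse x x≉0)
    x⁻¹x≈1 = trans (*-comm x⁻¹ x) (proj₂ (inverse x x≉0))

  *≈0 : ∀ {x y} → x ≉ 0# → x * y ≈ 0# → y ≈ 0#
  *≈0 x≉0 xy≈0 = *-cancelˡ-nonzero x≉0 (trans xy≈0 (sym (zeroʳ _)))

  *≉0 : ∀ {x y} → x ≉ 0# → y ≉ 0# → x * y ≉ 0#
  *≉0 x≉0 y≉0 xy≈0 = y≉0 (*≈0 x≉0 xy≈0)

  ^≉0 : ∀ {x} k → x ≉ 0# → x ^ k ≉ 0#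
  ^≉0 zero    x≉0 = 1≉0
  ^≉0 (suc k) x≉0 = *≉0 x≉0 (^≉0 k x≉0)

  ^≈0 : ∀ {x} k → x ^ k ≈ 0# → x ≈ 0#
  ^≈0 {x} k x^k≈0 with x ≟ 0#
  ... | yes x≈0 = x≈0
  ... | no  x≉0 = ⊥-elim (^≉0 k x≉0 x^k≈0)

  size : HasSize setoid U n
  size = record
    { elem     = E.from
    ; sound    = _
    ; distinct = λ i j eq → ≡.trans (≡.sym (E.strictlyInverseˡ i)) (≡.trans (E.to-cong eq) (E.strictlyInverseˡ j))
    ; complete = λ x _ → E.to x , sym (E.strictlyInverseʳ x)
    }

  module _ (f g : Carrier → Carrier) (f-cong : ∀ {x y} → x ≈ y → f x ≈ f y) (g-cong : ∀ {x y} → x ≈ y → g x ≈ g y)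
           (fg : ∀ x → f (g x) ≈ x) (gf : ∀ x → g (f x) ≈ x) where

    permutation : Fin n ↔ Fin n
    permutation = mk↔ₛ′ (E.to ∘ f ∘ E.from) (E.to ∘ g ∘ E.from)
      (λ i → ≡.trans (E.to-cong (trans (f-cong (E.strictlyInverseʳ _)) (fg _))) (E.strictlyInverseˡ i))
      (λ i → ≡.trans (E.to-cong (trans (g-cong (E.strictlyInverseʳ _)) (gf _))) (E.strictlyInverseˡ i))

  -- Adding 1 permutes F, so the sum of all elements equals itself plus `n ×ₙ 1#`.
  n×1≈0 : n ×ₙ 1# ≈ 0#
  n×1≈0 = +-cancelˡ _ _ _ (begin
    +.sum E.from + n ×ₙ 1#                     ≈⟨ +-congˡ (+.sum-replicate n) ⟨
    +.sum E.from + +.sum {n} (λ _ → 1#)       ≈⟨ +.∑-distrib-+ E.from (λ _ → 1#) ⟨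
    +.sum (λ i → E.from i + 1#)               ≈⟨ +.sum-cong-≋ {n} (λ i → E.strictlyInverseʳ (E.from i + 1#)) ⟨
    +.sum (λ i → E.from (E.to (E.from i + 1#))) ≈⟨ +.sum-permute E.from shift ⟨
    +.sum E.from                              ≈⟨ +-identityʳ _ ⟨
    +.sum E.from + 0#                         ∎)
    where
    open RingProperties ring using (+-cancelˡ)
    shift = permutation (_+ 1#) (_+ (- 1#)) +-congʳ +-congʳ
      (λ x → trans (+-assoc x _ _) (trans (+-congˡ (-‿inverseˡ 1#)) (+-identityʳ x)))
      (λ x → trans (+-assoc x _ _) (trans (+-congˡ (-‿inverseʳ 1#)) (+-identityʳ x)))

  -- Holds because F has no zero divisors. Applied twice to n = (2^e)^2, it yields characteristic 2.
  ^×ₙ1≈0 : ∀ a k → (a ℕ.^ k) ×ₙ 1# ≈ 0# → a ×ₙ 1# ≈ 0#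
  ^×ₙ1≈0 a zero    eq = ⊥-elim (1≉0 (trans (sym (+-identityʳ 1#)) eq))
  ^×ₙ1≈0 a (suc k) eq with a ×ₙ 1# ≟ 0#
  ... | yes a≈0 = a≈0
  ... | no  a≉0 = ^×ₙ1≈0 a k (*≈0 a≉0 (trans (sym (×1-homo-* a (a ℕ.^ k))) eq))

  ∏-single : ∀ {k} (t : Vector Carrier k) j → (∀ i → ¬ i ≡ j → t i ≈ 1#) → *.sum t ≈ t j
  ∏-single {suc k} t j t≈1 = trans (*.sum-remove {i = j} t) (trans (*-congˡ
    (trans (*.sum-cong-≋ λ i → t≈1 _ (Fin.punchInᵢ≢i j i)) (*.sum-replicate-zero k))) (*-identityʳ _))

  ∏-nonzero : ∀ {k} (t : Vector Carrier k) → (∀ i → t i ≉ 0#) → *.sum t ≉ 0#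
  ∏-nonzero {zero}  t t≉0 = 1≉0
  ∏-nonzero {suc k} t t≉0 = *≉0 (t≉0 zero) (∏-nonzero (t ∘ suc) (t≉0 ∘ suc))

  private
    replace0 : Carrier → Carrier → Carrier → Carrier
    replace0 z y x with x ≟ 0#
    ... | yes _ = z
    ... | no  _ = y

  -- Multiplication by a permutes F; for the product over F with the factor 0 replaced by 1 this gives aⁿ = a.
  x^n≈x : ∀ x → x ≉ 0# → x ^ n ≈ x
  x^n≈x a a≉0 = *-cancelˡ-nonzero (∏-nonzero (g ∘ E.from) (λ i → g≉0 _)) (begin
    *.sum (g ∘ E.from) * a ^ n                      ≈⟨ *-comm _ _ ⟩
    a ^ n * *.sum (g ∘ E.from)                      ≈⟨ *-congʳ (*.sum-replicate n) ⟨
    *.sum {n} (λ _ → a) * *.sum (g ∘ E.from)        ≈⟨ *.∑-distrib-+ (λ _ → a) (g ∘ E.from) ⟨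
    *.sum (λ i → a * g (E.from i))                  ≈⟨ *.sum-cong-≋ (λ i → g-scale (E.from i)) ⟩
    *.sum (λ i → g (a * E.from i) * k (E.from i))   ≈⟨ *.∑-distrib-+ _ (k ∘ E.from) ⟩
    *.sum (λ i → g (a * E.from i)) * *.sum (k ∘ E.from)
      ≈⟨ *-congʳ (*.sum-cong-≋ {n} (λ i → g-cong (E.strictlyInverseʳ (a * E.from i)))) ⟨
    *.sum (λ i → g (E.from (E.to (a * E.from i)))) * *.sum (k ∘ E.from)
      ≈⟨ *-congʳ (*.sum-permute (g ∘ E.from) scale) ⟨
    *.sum (g ∘ E.from) * *.sum (k ∘ E.from)         ≈⟨ *-congˡ (∏-single (k ∘ E.from) (E.to 0#) k≈1) ⟩
    *.sum (g ∘ E.from) * k (E.from (E.to 0#))       ≈⟨ *-congˡ k0≈a ⟩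
    *.sum (g ∘ E.from) * a                          ∎)
    where
    g : Carrier → Carrier
    g x = replace0 1# x x
    -- The correction at x = 0, where a * g 0 = a but g (a * 0) = 1. Over all of F it contributes
    -- exactly one factor a.
    k : Carrier → Carrier
    k x = replace0 a 1# x
    g≉0 : ∀ x → g x ≉ 0#
    g≉0 x with x ≟ 0#
    ... | yes _  = 1≉0
    ... | no x≉0 = x≉0
    g-cong : ∀ {x y} → x ≈ y → g x ≈ g y
    g-cong {x} {y} x≈y with x ≟ 0# | y ≟ 0#
    ... | yes _   | yes _   = refl
    ... | yes x≈0 | no  y≉0 = ⊥-elim (y≉0 (trans (sym x≈y) x≈0))
    ... | no  x≉0 | yes y≈0 = ⊥-elim (x≉0 (trans x≈y y≈0))
    ... | no  _   | no  _   = x≈y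
    g-scale : ∀ x → a * g x ≈ g (a * x) * k x
    g-scale x with x ≟ 0# | a * x ≟ 0#
    ... | yes _   | yes _    = *-comm a 1#
    ... | yes x≈0 | no  ax≉0 = ⊥-elim (ax≉0 (trans (*-congˡ x≈0) (zeroʳ a)))
    ... | no  x≉0 | yes ax≈0 = ⊥-elim (x≉0 (*≈0 a≉0 ax≈0))
    ... | no  _   | no  _    = sym (*-identityʳ _)
    k≈1 : ∀ i → ¬ i ≡ E.to 0# → k (E.from i) ≈ 1#
    k≈1 i i≢0 with E.from i ≟ 0#
    ... | yes eq = ⊥-elim (i≢0 (≡.trans (≡.sym (E.strictlyInverseˡ i)) (E.to-cong eq)))
    ... | no  _  = refl
    k0≈a : k (E.from (E.to 0#)) ≈ a
    k0≈a with E.from (E.to 0#) ≟ 0#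
    ... | yes _  = refl
    ... | no neq = ⊥-elim (neq (E.strictlyInverseʳ 0#))
    a⁻¹ = proj₁ (inverse a a≉0)
    aa⁻¹ = proj₂ (inverse a a≉0)
    scale = permutation (a *_) (a⁻¹ *_) *-congˡ *-congˡ
      (λ x → trans (sym (*-assoc _ _ x)) (trans (*-congʳ aa⁻¹) (*-identityˡ x)))
      (λ x → trans (sym (*-assoc _ _ x)) (trans (*-congʳ (trans (*-comm _ _) aa⁻¹)) (*-identityˡ x)))

-- Characteristic two and the powers of the Frobenius map.

module CharacteristicTwo {c ℓ} (R : CommutativeRing c ℓ)
  (1+1≈0 : CommutativeRing._≈_ R (CommutativeRing._+_ R (CommutativeRing.1# R) (CommutativeRing.1# R)) (CommutativeRing.0# R)) where

  open CommutativeRing R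
  open RingProperties ring
  open Exp commutativeSemiring
  open SetoidReasoning setoid

  private
    𝔽₂ = CommutativeRing.rawRing xor-∧-commutativeRing

    ⟦_⟧ : Bool → Carrier
    ⟦ false ⟧ = 0#
    ⟦ true ⟧  = 1#

    -1≈1 : - 1# ≈ 1#
    -1≈1 = sym (+-inverseˡ-unique 1# 1# 1+1≈0)

    morphism : 𝔽₂ -Raw-AlmostCommutative⟶ fromCommutativeRing R
    morphism = record
      { ⟦_⟧    = ⟦_⟧
      ; +-homo = λ { false b → sym (+-identityˡ _) ; true false → sym (+-identityʳ _) ; true true → sym 1+1≈0 }
      ; *-homo = λ { false b → sym (zeroˡ _) ; true b → sym (*-identityˡ _) }
      ; -‿homo = λ { false → sym -0#≈0# ; true → sym -1≈1 }
      ; 0-homo = refl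
      ; 1-homo = refl
      }

    _coeff≟_ : ∀ a b → Maybe (⟦ a ⟧ ≈ ⟦ b ⟧)
    false coeff≟ false = just refl
    true  coeff≟ true  = just refl
    _     coeff≟ _     = nothing

  -- Coefficients in 𝔽₂ make the solver normalise modulo 2: equal terms cancel in pairs and signs
  -- disappear. `con true` and `con false` stand for 1 and 0.
  module 𝔽₂-Solver = RingSolver 𝔽₂ (fromCommutativeRing R) morphism _coeff≟_
  open 𝔽₂-Solver using (solve; _:+_; _:*_; _:=_; con; :-_)

  x+x≈0 : ∀ x → x + x ≈ 0#
  x+x≈0 = solve 1 (λ x → x :+ x := con false) refl

  -x≈x : ∀ x → - x ≈ x
  -x≈x = solve 1 (λ x → :- x := x) refl

  x+y≈0⇒x≈y : ∀ {x y} → x + y ≈ 0# → x ≈ y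
  x+y≈0⇒x≈y {x} {y} x+y≈0 = trans (+-inverseˡ-unique x y x+y≈0) (-x≈x y)

  x≈y⇒x+y≈0 : ∀ {x y} → x ≈ y → x + y ≈ 0#
  x≈y⇒x+y≈0 {x} {y} x≈y = trans (+-congʳ x≈y) (x+x≈0 y)

  x+y+y≈x : ∀ x y → x + y + y ≈ x
  x+y+y≈x = solve 2 (λ x y → x :+ y :+ y := x) refl

  frob : ℕ → Carrier → Carrier
  frob k x = x ^ (2 ℕ.^ k)

  frob-cong : ∀ k {x y} → x ≈ y → frob k x ≈ frob k y
  frob-cong k = ^-congˡ (2 ℕ.^ k)

  frob-* : ∀ k x y → frob k (x * y) ≈ frob k x * frob k y
  frob-* k x y = ^-distrib-* x y (2 ℕ.^ k)

  frob-∘ : ∀ j k x → frob k (frob j x) ≈ frob (j ℕ.+ k) x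
  frob-∘ j k x = trans (^-assocʳ x (2 ℕ.^ j) (2 ℕ.^ k)) (^-congʳ x (≡.sym (ℕ.^-distribˡ-+-* 2 j k)))

  frob-1 : ∀ x → frob 1 x ≈ x * x
  frob-1 x = *-congˡ (*-identityʳ x)

  frob-suc : ∀ k x → frob (suc k) x ≈ frob k x * frob k x
  frob-suc k x = trans (^-congʳ x (ℕ.*-comm 2 (2 ℕ.^ k))) (trans (sym (^-assocʳ x (2 ℕ.^ k) 2)) (frob-1 _))

  frob-0 : ∀ x → frob 0 x ≈ x
  frob-0 = *-identityʳ

  frob-+ : ∀ k x y → frob k (x + y) ≈ frob k x + frob k y
  frob-+ ℕ.zero x y = trans (frob-0 _) (sym (+-cong (frob-0 x) (frob-0 y)))
  frob-+ (suc k) x y = begin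
    frob (suc k) (x + y)                                ≈⟨ frob-suc k _ ⟩
    frob k (x + y) * frob k (x + y)                     ≈⟨ *-cong (frob-+ k x y) (frob-+ k x y) ⟩
    (frob k x + frob k y) * (frob k x + frob k y)
      ≈⟨ solve 2 (λ X Y → (X :+ Y) :* (X :+ Y) := X :* X :+ Y :* Y) refl (frob k x) (frob k y) ⟩
    frob k x * frob k x + frob k y * frob k y           ≈⟨ +-cong (frob-suc k x) (frob-suc k y) ⟨
    frob (suc k) x + frob (suc k) y                     ∎

  frob-zero : ∀ k → frob k 0# ≈ 0#
  frob-zero ℕ.zero  = frob-0 0#
  frob-zero (suc k) = trans (frob-suc k 0#) (trans (*-congʳ (frob-zero k)) (zeroˡ _))

  frob-one : ∀ k → frob k 1# ≈ 1#
  frob-one ℕ.zero  = frob-0 1#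
  frob-one (suc k) = trans (frob-suc k 1#) (trans (*-cong (frob-one k) (frob-one k)) (*-identityˡ 1#))

-- The quadratic extension F of K = GF(q).

square-injective : ∀ {m n} → m ℕ.* m ≡ n ℕ.* n → m ≡ n
square-injective {m} {n} eq with ℕ.<-cmp m n
... | tri< m<n _ _ = ⊥-elim (ℕ.<⇒≢ (ℕ.*-mono-< m<n m<n) eq)

... | tri≈ _ m≡n _ = m≡n
... | tri> _ _ n<m = ⊥-elim (ℕ.<⇒≢ (ℕ.*-mono-< n<m n<m) (≡.sym eq))

module QuadraticExtension {c ℓ} (e : ℕ) (F : FiniteField c ℓ ((2 ℕ.^ e) ℕ.^ 2)) where

  q = 2 ℕ.^ e

  open FiniteField F hiding (zero) renaming (_≟_ to infix 4 _≟_)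
  open FiniteFieldProperties F
  open Exp commutativeSemiring
  open SetoidReasoning setoid

  1+1≈0 : 1# + 1# ≈ 0#
  1+1≈0 = trans (+-congˡ (sym (+-identityʳ 1#))) (^×ₙ1≈0 2 e (^×ₙ1≈0 q 2 n×1≈0))

  open CharacteristicTwo commutativeRing 1+1≈0 public
  open 𝔽₂-Solver using (solve; _:+_; _:*_; _:=_; con)

  -- `frob k` is additive, and its kernel is trivial because a field has no nilpotent elements.
  frob-injective : ∀ k {x y} → frob k x ≈ frob k y → x ≈ y
  frob-injective k {x} {y} eq = x+y≈0⇒x≈y (^≈0 (2 ℕ.^ k) (trans (frob-+ k x y) (x≈y⇒x+y≈0 eq)))

  frob-e-involutive : ∀ x → frob e (frob e x) ≈ x
  frob-e-involutive x with x ≟ 0#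
  ... | yes x≈0 = trans (frob-cong e (frob-cong e x≈0)) (trans (frob-cong e (frob-zero e)) (trans (frob-zero e) (sym x≈0)))
  ... | no x≉0  = begin
    frob e (frob e x)   ≈⟨ ^-assocʳ x q q ⟩
    x ^ (q ℕ.* q)       ≈⟨ ^-congʳ x (≡.cong (q ℕ.*_) (ℕ.*-identityʳ q)) ⟨
    x ^ (q ℕ.^ 2)       ≈⟨ x^n≈x x x≉0 ⟩
    x                   ∎

  infix 4 _∈K
  _∈K : Carrier → Set ℓ
  x ∈K = frob e x ≈ x

  ∈K-resp : ∀ {x y} → x ≈ y → x ∈K → y ∈K
  ∈K-resp x≈y x∈K = trans (frob-cong e (sym x≈y)) (trans x∈K x≈y)

  0∈K : 0# ∈K
  0∈K = frob-zero e

  1∈K : 1# ∈K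
  1∈K = frob-one e

  +∈K : ∀ {x y} → x ∈K → y ∈K → x + y ∈K
  +∈K x∈K y∈K = trans (frob-+ e _ _) (+-cong x∈K y∈K)

  *∈K : ∀ {x y} → x ∈K → y ∈K → x * y ∈K
  *∈K x∈K y∈K = trans (frob-* e _ _) (*-cong x∈K y∈K)

  frob-comm : ∀ j k x → frob j (frob k x) ≈ frob k (frob j x)
  frob-comm j k x = trans (frob-∘ k j x) (trans (^-congʳ x (≡.cong (2 ℕ.^_) (ℕ.+-comm k j))) (sym (frob-∘ j k x)))

  frob∈K : ∀ k {x} → x ∈K → frob k x ∈K
  frob∈K k x∈K = trans (frob-comm e k _) (frob-cong k x∈K)

  inverse∈K : ∀ {x y} → x * y ≈ 1# → x ∈K → y ∈K
  inverse∈K {x} {y} xy≈1 x∈K = *-cancelˡ-nonzero x≉0 (begin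
    x * frob e y          ≈⟨ *-congʳ x∈K ⟨
    frob e x * frob e y   ≈⟨ frob-* e x y ⟨
    frob e (x * y)        ≈⟨ frob-cong e xy≈1 ⟩
    frob e 1#             ≈⟨ 1∈K ⟩
    1#                    ≈⟨ xy≈1 ⟨
    x * y                 ∎)
    where
    x≉0 : x ≉ 0#
    x≉0 x≈0 = 1≉0 (trans (sym xy≈1) (trans (*-congʳ x≈0) (zeroˡ y)))

  Tr : Carrier → Carrier
  Tr x = frob e x + x

  Tr-cong : ∀ {x y} → x ≈ y → Tr x ≈ Tr y
  Tr-cong x≈y = +-cong (frob-cong e x≈y) x≈y

  Tr-+ : ∀ x y → Tr (x + y) ≈ Tr x + Tr y
  Tr-+ x y = trans (+-congʳ (frob-+ e x y))
    (solve 4 (λ X Y x y → X :+ Y :+ (x :+ y) := X :+ x :+ (Y :+ y)) refl (frob e x) (frob e y) x y)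

  Tr-* : ∀ {s} x → s ∈K → Tr (x * s) ≈ Tr x * s
  Tr-* {s} x s∈K = trans (+-congʳ (trans (frob-* e x s) (*-congˡ s∈K))) (sym (distribʳ s _ x))

  Tr∈K : ∀ x → Tr x ∈K
  Tr∈K x = trans (frob-+ e _ x) (trans (+-congʳ (frob-e-involutive x)) (+-comm x _))

  -- Squaring sends ε to ε + δ, so each further squaring adds one more conjugate of δ.
  -- `absoluteTrace` serves here as a partial sum of arbitrary length k.
  frob-root : ∀ {ε δ} → ε ^ 2 + ε + δ ≈ 0# → ∀ k → frob k ε ≈ ε + OverField.absoluteTrace F k δ
  frob-root {ε} {δ} root zero    = trans (frob-0 ε) (sym (+-identityʳ ε))
  frob-root {ε} {δ} root (suc k) = begin
    frob (suc k) ε                                  ≈⟨ frob-∘ 1 k ε ⟨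
    frob k (frob 1 ε)                               ≈⟨ frob-cong k ε²≈ ⟩
    frob k (ε + δ)                                  ≈⟨ frob-+ k ε δ ⟩
    frob k ε + frob k δ                             ≈⟨ +-congʳ (frob-root root k) ⟩
    ε + OverField.absoluteTrace F k δ + frob k δ    ≈⟨ +-assoc _ _ _ ⟩
    ε + (OverField.absoluteTrace F k δ + frob k δ)
      -- The new summand `frob k δ` is the last one, so the sum is split at its end and not at its
      -- head.
      ≈⟨ +-congˡ (+-cong (+.sum-cong-≋ {k} λ i → ^-congʳ δ (≡.cong (2 ℕ.^_) (Fin.toℕ-inject₁ i)))
                         (^-congʳ δ (≡.cong (2 ℕ.^_) (Fin.toℕ-fromℕ k)))) ⟨
    ε + (+.sum {k} _ + _)                           ≈⟨ +-congˡ (+.sum-init-last {k} (λ i → δ ^ (2 ℕ.^ toℕ i))) ⟨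
    ε + OverField.absoluteTrace F (suc k) δ         ∎
    where
    module + = Sum +-commutativeMonoid
    ε²≈ : frob 1 ε ≈ ε + δ
    ε²≈ = x+y≈0⇒x≈y (trans (sym (+-assoc _ ε δ)) root)

  EpsilonConjugate : Carrier → Set ℓ
  EpsilonConjugate ε = frob e ε ≈ ε + 1#

  module Coordinates (ε : Carrier) (ε^q≈ε+1 : EpsilonConjugate ε) where

    F² = ×-setoid setoid setoid

    K² : Pred (Carrier × Carrier) ℓ
    K² (s , t) = s ∈K × t ∈K

    -- The coordinate of 1 in the basis 1, ε; the coordinate of ε is `Tr x`, since ε^q + ε = 1. It
    -- is also the bracket that Γ raises to the power σ + 2.
    re : Carrier → Carrier
    re x = x + Tr x * ε

    re-cong : ∀ {x y} → x ≈ y → re x ≈ re y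
    re-cong x≈y = +-cong x≈y (*-congʳ (Tr-cong x≈y))

    re∈K : ∀ x → re x ∈K
    re∈K x = begin
      frob e (x + Tr x * ε)                ≈⟨ frob-+ e _ _ ⟩
      frob e x + frob e (Tr x * ε)         ≈⟨ +-congˡ (frob-* e _ _) ⟩
      frob e x + frob e (Tr x) * frob e ε  ≈⟨ +-congˡ (*-cong (Tr∈K x) ε^q≈ε+1) ⟩
      frob e x + Tr x * (ε + 1#)
        ≈⟨ solve 3 (λ x X ε → X :+ (X :+ x) :* (ε :+ con true) := x :+ (X :+ x) :* ε) refl x (frob e x) ε ⟩
      x + Tr x * ε                         ∎

    re-Tr : ∀ x → re x + Tr x * ε ≈ x
    re-Tr x = x+y+y≈x x (Tr x * ε)

    Tr-coordinates : ∀ {s t} → s ∈K → t ∈K → Tr (s + t * ε) ≈ t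
    Tr-coordinates {s} {t} s∈K t∈K = begin
      frob e (s + t * ε) + (s + t * ε)   ≈⟨ +-congʳ (trans (frob-+ e _ _) (+-cong s∈K (trans (frob-* e t ε) (*-cong t∈K ε^q≈ε+1)))) ⟩
      s + t * (ε + 1#) + (s + t * ε)
        ≈⟨ solve 3 (λ s t ε → s :+ t :* (ε :+ con true) :+ (s :+ t :* ε) := t) refl s t ε ⟩
      t                                  ∎

    re-coordinates : ∀ {s t} → s ∈K → t ∈K → re (s + t * ε) ≈ s
    re-coordinates {s} {t} s∈K t∈K = trans (+-congˡ (*-congʳ (Tr-coordinates s∈K t∈K))) (x+y+y≈x s (t * ε))

    private
      K-filtered = hasSize-filter setoid ∈K-resp (λ x → frob e x ≟ x) size

    -- The coordinates identify K × K with F. So the unknown size m of K satisfies m² = q².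
    K-size : HasSize setoid _∈K q
    K-size = ≡.subst (HasSize setoid _∈K) m≡q K-hasSize
      where
      m = proj₁ K-filtered
      K-hasSize : HasSize setoid _∈K m
      K-hasSize = hasSize-⇔ setoid (λ _ → proj₂) (λ _ → _ ,_) (proj₂ K-filtered)
      F-hasSize : HasSize setoid U (m ℕ.* m)
      F-hasSize = hasSize-map F² setoid (λ (s , t) → s + t * ε) (λ (s≈ , t≈) → +-cong s≈ (*-congʳ t≈)) _
        (λ (s , t) (s′ , t′) (s∈K , t∈K) (s′∈K , t′∈K) eq →
           trans (sym (re-coordinates s∈K t∈K)) (trans (re-cong eq) (re-coordinates s′∈K t′∈K)) ,
           trans (sym (Tr-coordinates s∈K t∈K)) (trans (Tr-cong eq) (Tr-coordinates s′∈K t′∈K)))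
        (λ x _ → (re x , Tr x) , (re∈K x , Tr∈K x) , sym (re-Tr x))
        (hasSize-Σ setoid setoid (λ _ _ t∈K → t∈K) K-hasSize (λ _ _ → K-hasSize))
      m≡q : m ≡ q
      m≡q = square-injective (≡.trans (hasSize-unique setoid F-hasSize size) (≡.cong (q ℕ.*_) (ℕ.*-identityʳ q)))

    K²-size : HasSize F² K² (q ℕ.* q)
    K²-size = hasSize-Σ setoid setoid (λ _ _ t∈K → t∈K) K-size (λ _ _ → K-size)

    Tr-fibre-size : ∀ {γ} → γ ∈K → HasSize setoid (λ x → Tr x ≈ γ) q
    Tr-fibre-size {γ} γ∈K = hasSize-map setoid setoid (λ s → s + γ * ε) +-congʳ
      (λ s s∈K → Tr-coordinates s∈K γ∈K)
      (λ s s′ s∈K s′∈K eq → trans (sym (re-coordinates s∈K γ∈K)) (trans (re-cong eq) (re-coordinates s′∈K γ∈K)))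
      (λ x Trx≈γ → re x , re∈K x , trans (sym (re-Tr x)) (+-congˡ (*-congʳ Trx≈γ)))
      K-size

-- The Suzuki-Tits form on K² and its fibres.

nonunit-count : ∀ {q m} → 2 ℕ.≤ q → (q ℕ.∸ 1) ℕ.* m ≡ q ℕ.* q ℕ.∸ 1 → m ≡ q ℕ.+ 1
nonunit-count {suc (suc p)} {m} (ℕ.s≤s (ℕ.s≤s _)) eq = ℕ.*-cancelˡ-≡ m (suc (suc p) ℕ.+ 1) (suc p)
  (≡.trans eq (solve 1 (λ p → con 1 :+ p :+ (con 1 :+ p) :* (con 2 :+ p) := (con 1 :+ p) :* (con 2 :+ p :+ con 1)) ≡.refl p))
  where open ℕ.+-*-Solver

module SuzukiOvoid {c ℓ} (e k : ℕ) (k+1+k≡e : k ℕ.+ suc k ≡ e) (F : FiniteField c ℓ ((2 ℕ.^ e) ℕ.^ 2))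
  (ε : FiniteField.Carrier F) where

  open FiniteField F hiding (zero) renaming (_≟_ to infix 4 _≟_)
  open FiniteFieldProperties F
  open QuadraticExtension e F
  open SetoidReasoning setoid
  open 𝔽₂-Solver using (solve; _:+_; _:*_; _:=_; con)

  2≤q : 2 ℕ.≤ q
  2≤q = ℕ.^-monoʳ-≤ 2 (≡.subst (1 ℕ.≤_) k+1+k≡e (ℕ.m≤n⇒m≤o+n k (ℕ.s≤s ℕ.z≤n)))

  φ : Carrier → Carrier
  φ = frob (suc k)

  φ-cong : ∀ {x y} → x ≈ y → φ x ≈ φ y
  φ-cong = frob-cong (suc k)

  -- Because 2 (k + 1) = e + 1 and `frob e` is the identity on K, φ is a square root of the
  -- Frobenius map on K. This is the Tits endomorphism that defines the Suzuki groups.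
  φ-φ : ∀ {x} → x ∈K → φ (φ x) ≈ x * x
  φ-φ {x} x∈K = begin
    φ (φ x)                   ≈⟨ frob-∘ (suc k) (suc k) x ⟩
    frob (suc (k ℕ.+ suc k)) x ≡⟨ ≡.cong (λ i → frob (suc i) x) k+1+k≡e ⟩
    frob (suc e) x            ≈⟨ frob-suc e x ⟩
    frob e x * frob e x       ≈⟨ *-cong x∈K x∈K ⟩
    x * x                     ∎

  suzuki : Carrier × Carrier → Carrier
  suzuki (s , t) = φ s * (s * s) + s * t + φ t

  suzuki-cong : ∀ {s s′ t t′} → s ≈ s′ → t ≈ t′ → suzuki (s , t) ≈ suzuki (s′ , t′)
  suzuki-cong s≈ t≈ = +-cong (+-cong (*-cong (φ-cong s≈) (*-cong s≈ s≈)) (*-cong s≈ t≈)) (φ-cong t≈)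

  suzuki∈K : ∀ {s t} → s ∈K → t ∈K → suzuki (s , t) ∈K
  suzuki∈K s∈K t∈K = +∈K (+∈K (*∈K (frob∈K (suc k) s∈K) (*∈K s∈K s∈K)) (*∈K s∈K t∈K)) (frob∈K (suc k) t∈K)

  -- The multiplier c φ(c) of t is chosen so that φ (c φ(c)) = φ(c) c²; all three terms then acquire
  -- the same factor.
  suzuki-scale : ∀ {c} s t → c ∈K → suzuki (c * s , c * φ c * t) ≈ φ c * (c * c) * suzuki (s , t)
  suzuki-scale {c} s t c∈K = begin
    suzuki (c * s , c * φ c * t)
      ≈⟨ +-cong (+-congʳ (*-congʳ (frob-* (suc k) c s)))
                (trans (frob-* (suc k) _ t) (*-congʳ (trans (frob-* (suc k) c (φ c)) (*-congˡ (φ-φ c∈K))))) ⟩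
    φ c * φ s * (c * s * (c * s)) + c * s * (c * φ c * t) + φ c * (c * c) * φ t
      ≈⟨ solve 6 (λ c C s S t T → C :* S :* (c :* s :* (c :* s)) :+ c :* s :* (c :* C :* t) :+ C :* (c :* c) :* T
                               := C :* (c :* c) :* (S :* (s :* s) :+ s :* t :+ T)) refl c (φ c) s (φ s) t (φ t) ⟩
    φ c * (c * c) * suzuki (s , t) ∎

  -- The shear term φ(u) s in the second coordinate cancels both mixed terms of φ(s + u) (s + u)²:
  -- the term φ(s) u² through φ (φ(u) s) = u² φ(s), and the term φ(u) s² through the product s ·
  -- φ(u) s. Apart from the form itself, only an affine function of s and t is left.
  suzuki-translate : ∀ {u} v s t → u ∈K →
    suzuki (s + u , t + (φ u * s + v)) ≈ suzuki (s , t) + ((v + φ u * u) * s + u * t) + suzuki (u , v)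
  suzuki-translate {u} v s t u∈K = begin
    suzuki (s + u , t + (φ u * s + v))
      ≈⟨ +-cong (+-congʳ (*-congʳ (frob-+ (suc k) s u)))
                (trans (frob-+ (suc k) t _) (+-congˡ (trans (frob-+ (suc k) _ v)
                  (+-congʳ (trans (frob-* (suc k) (φ u) s) (*-congʳ (φ-φ u∈K))))))) ⟩
    (φ s + φ u) * ((s + u) * (s + u)) + (s + u) * (t + (φ u * s + v)) + (φ t + (u * u * φ s + φ v))
      ≈⟨ solve 8 (λ s t u v S T U V →
           (S :+ U) :* ((s :+ u) :* (s :+ u)) :+ (s :+ u) :* (t :+ (U :* s :+ v)) :+ (T :+ (u :* u :* S :+ V))
           := S :* (s :* s) :+ s :* t :+ T :+ ((v :+ U :* u) :* s :+ u :* t) :+ (U :* (u :* u) :+ u :* v :+ V))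
           refl s t u v (φ s) (φ t) (φ u) (φ v) ⟩
    suzuki (s , t) + ((v + φ u * u) * s + u * t) + suzuki (u , v) ∎

  -- Applying φ twice to such a t gives t² = t + 1 + 1 = t. An idempotent is fixed by every power of
  -- the Frobenius map, so φ t = t as well, whence 1 = 0.
  φ≉+1 : ∀ {t} → t ∈K → ¬ φ t ≈ t + 1#
  φ≉+1 {t} t∈K φt≈t+1 = 1≉0 (begin
    1#            ≈⟨ solve 1 (λ t → con true := t :+ con true :+ t) refl t ⟩
    t + 1# + t    ≈⟨ +-congʳ (sym φt≈t+1) ⟩
    φ t + t       ≈⟨ x≈y⇒x+y≈0 φt≈t ⟩
    0#            ∎)
    where
    tt≈t : t * t ≈ t
    tt≈t = begin
      t * t          ≈⟨ φ-φ t∈K ⟨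
      φ (φ t)        ≈⟨ φ-cong φt≈t+1 ⟩
      φ (t + 1#)     ≈⟨ frob-+ (suc k) t 1# ⟩
      φ t + φ 1#     ≈⟨ +-cong φt≈t+1 (frob-one (suc k)) ⟩
      t + 1# + 1#    ≈⟨ x+y+y≈x t 1# ⟩
      t              ∎
    φt≈t : φ t ≈ t
    φt≈t = idempotent-frob (suc k)
      where
      idempotent-frob : ∀ j → frob j t ≈ t
      idempotent-frob zero    = frob-0 t
      idempotent-frob (suc j) = trans (frob-suc j t) (trans (*-cong (idempotent-frob j) (idempotent-frob j)) tt≈t)

  suzuki≈0 : ∀ {s t} → s ∈K → t ∈K → suzuki (s , t) ≈ 0# → s ≈ 0# × t ≈ 0#
  suzuki≈0 {s} {t} s∈K t∈K f≈0 with s ≟ 0#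
  ... | yes s≈0 = s≈0 , ^≈0 (2 ℕ.^ suc k) (begin
    φ t                                ≈⟨ solve 3 (λ S t T → T := S :* (con false :* con false) :+ con false :* t :+ T) refl (φ s) t (φ t) ⟩
    φ s * (0# * 0#) + 0# * t + φ t     ≈⟨ +-congʳ (+-cong (*-congˡ (*-cong s≈0 s≈0)) (*-congʳ s≈0)) ⟨
    suzuki (s , t)                     ≈⟨ f≈0 ⟩
    0#                                 ∎)
  -- Scaling by r = 1 / s moves the zero to s = 1, where the form is 1 + t′ + φ t′.
  ... | no s≉0 = ⊥-elim (φ≉+1 t′∈K (x+y≈0⇒x≈y (begin
    φ t′ + (t′ + 1#)                   ≈⟨ solve 2 (λ t T → T :+ (t :+ con true) := con true :* (con true :* con true) :+ con true :* t :+ T) refl t′ (φ t′) ⟩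
    1# * (1# * 1#) + 1# * t′ + φ t′    ≈⟨ +-congʳ (+-congʳ (*-congʳ (frob-one (suc k)))) ⟨
    suzuki (1# , t′)                   ≈⟨ suzuki-cong rs≈1 refl ⟨
    suzuki (r * s , t′)                ≈⟨ suzuki-scale s t r∈K ⟩
    φ r * (r * r) * suzuki (s , t)     ≈⟨ *-congˡ f≈0 ⟩
    φ r * (r * r) * 0#                 ≈⟨ zeroʳ _ ⟩
    0#                                 ∎)))
    where
    r = proj₁ (inverse s s≉0)
    rs≈1 = trans (*-comm r s) (proj₂ (inverse s s≉0))
    r∈K = inverse∈K (proj₂ (inverse s s≉0)) s∈K
    t′ = r * φ r * t
    t′∈K = *∈K (*∈K r∈K (frob∈K (suc k) r∈K)) t∈K

  -- Since φ (frob k γ) = γ on K, the quotient c = γ / frob k γ works.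
  norm-surjective : ∀ {γ} → γ ∈K → γ ≉ 0# → ∃ λ c → c ∈K × φ c * (c * c) ≈ γ
  norm-surjective {γ} γ∈K γ≉0 = γ * ρ , *∈K γ∈K ρ∈K , (begin
    φ (γ * ρ) * (γ * ρ * (γ * ρ))      ≈⟨ *-congʳ (trans (frob-* (suc k) γ ρ) (*-congʳ (frob-suc k γ))) ⟩
    ψ * ψ * φ ρ * (γ * ρ * (γ * ρ))    ≈⟨ solve 4 (λ γ ρ ψ φρ → ψ :* ψ :* φρ :* (γ :* ρ :* (γ :* ρ))
                                            := ψ :* ρ :* (ψ :* ρ) :* (γ :* φρ) :* γ) refl γ ρ ψ (φ ρ) ⟩
    ψ * ρ * (ψ * ρ) * (γ * φ ρ) * γ    ≈⟨ *-congʳ (*-cong (*-cong ψρ≈1 ψρ≈1) γφρ≈1) ⟩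
    1# * 1# * 1# * γ                   ≈⟨ solve 1 (λ γ → con true :* con true :* con true :* γ := γ) refl γ ⟩
    γ                                  ∎)
    where
    ψ = frob k γ
    ψ⁻¹ = inverse ψ (^≉0 (2 ℕ.^ k) γ≉0)
    ρ = proj₁ ψ⁻¹
    ψρ≈1 = proj₂ ψ⁻¹
    ρ∈K = inverse∈K ψρ≈1 (frob∈K k γ∈K)
    γφρ≈1 : γ * φ ρ ≈ 1#
    γφρ≈1 = begin
      γ * φ ρ                    ≈⟨ *-congʳ γ∈K ⟨
      frob e γ * φ ρ             ≡⟨ ≡.cong (λ i → frob i γ * φ ρ) k+1+k≡e ⟨
      frob (k ℕ.+ suc k) γ * φ ρ ≈⟨ *-congʳ (frob-∘ k (suc k) γ) ⟨
      φ ψ * φ ρ                  ≈⟨ frob-* (suc k) ψ ρ ⟨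
      φ (ψ * ρ)                  ≈⟨ φ-cong ψρ≈1 ⟩
      φ 1#                       ≈⟨ frob-one (suc k) ⟩
      1#                         ∎

  module _ (ε^q≈ε+1 : frob e ε ≈ ε + 1#) where
    open Coordinates ε ε^q≈ε+1

    Fibre : Carrier → Pred (Carrier × Carrier) ℓ
    Fibre γ st = K² st × suzuki st ≈ γ

    fibre-resp : ∀ {γ x y} → Setoid._≈_ F² x y → suzuki x ≈ γ → suzuki y ≈ γ
    fibre-resp (s≈ , t≈) eq = trans (suzuki-cong (sym s≈) (sym t≈)) eq

    fibre-0-size : HasSize F² (Fibre 0#) 1
    fibre-0-size = hasSize-1 F² (0# , 0#) ((0∈K , 0∈K) , suzuki-0) λ (s , t) ((s∈K , t∈K) , f≈0) → suzuki≈0 s∈K t∈K f≈0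
      where
      suzuki-0 : suzuki (0# , 0#) ≈ 0#
      suzuki-0 = trans (+-congˡ (frob-zero (suc k)))
        (solve 1 (λ x → x :* (con false :* con false) :+ con false :* con false :+ con false := con false) refl (φ 0#))

    private
      m : ℕ
      m = proj₁ (hasSize-filter F² fibre-resp (λ x → suzuki x ≟ 1#) K²-size)

      fibre-1-size : HasSize F² (Fibre 1#) m
      fibre-1-size = proj₂ (hasSize-filter F² fibre-resp (λ x → suzuki x ≟ 1#) K²-size)

      -- Scaling by l with φ(l) l² = γ carries the fibre over 1 onto the fibre over γ.
      fibre-m : ∀ {γ} → γ ∈K → γ ≉ 0# → HasSize F² (Fibre γ) m
      fibre-m {γ} γ∈K γ≉0 = hasSize-map F² F²
        (λ (s , t) → l * s , l * φ l * t)
        (λ (s≈ , t≈) → *-congˡ s≈ , *-congˡ t≈)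
        (λ (s , t) ((s∈K , t∈K) , f≈1) → (*∈K l∈K s∈K , *∈K lφl∈K t∈K) ,
           trans (suzuki-scale s t l∈K) (trans (*-cong ll≈γ f≈1) (*-identityʳ γ)))
        (λ x y _ _ (s≈ , t≈) → *-cancelˡ-nonzero l≉0 s≈ , *-cancelˡ-nonzero lφl≉0 t≈)
        (λ (s , t) ((s∈K , t∈K) , f≈γ) →
           let s′ = proj₁ l⁻¹ * s ; t′ = proj₁ lφl⁻¹ * t
               s≈ : s ≈ l * s′
               s≈ = cancel (proj₂ l⁻¹) s
               t≈ : t ≈ l * φ l * t′
               t≈ = cancel (proj₂ lφl⁻¹) t
           in (s′ , t′) ,
              ((*∈K (inverse∈K (proj₂ l⁻¹) l∈K) s∈K , *∈K (inverse∈K (proj₂ lφl⁻¹) lφl∈K) t∈K) ,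
               *-cancelˡ-nonzero γ≉0 (trans (*-congʳ (sym ll≈γ)) (trans (sym (suzuki-scale s′ t′ l∈K))
                 (trans (suzuki-cong (sym s≈) (sym t≈)) (trans f≈γ (sym (*-identityʳ γ))))))) ,
              s≈ , t≈)
        fibre-1-size
        where
        l = proj₁ (norm-surjective γ∈K γ≉0)
        l∈K = proj₁ (proj₂ (norm-surjective γ∈K γ≉0))
        ll≈γ = proj₂ (proj₂ (norm-surjective γ∈K γ≉0))
        l≉0 : l ≉ 0#
        l≉0 l≈0 = γ≉0 (trans (sym ll≈γ) (trans (*-congˡ (trans (*-congʳ l≈0) (zeroˡ l))) (zeroʳ _)))
        lφl≉0 = *≉0 l≉0 (^≉0 (2 ℕ.^ suc k) l≉0)
        lφl∈K = *∈K l∈K (frob∈K (suc k) l∈K)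
        l⁻¹ = inverse l l≉0
        lφl⁻¹ = inverse (l * φ l) lφl≉0
        cancel : ∀ {a b} → a * b ≈ 1# → ∀ x → x ≈ a * (b * x)
        cancel {a} {b} ab≈1 x = sym (trans (sym (*-assoc a b x)) (trans (*-congʳ ab≈1) (*-identityˡ x)))

      -- Double count of the pairs (γ, (s, t)) with γ ≠ 0 and (s, t) in the fibre over γ: q - 1
      -- fibres of size m on one side, K² without the single zero of the form on the other.
      m≡q+1 : m ≡ q ℕ.+ 1
      m≡q+1 = nonunit-count 2≤q (hasSize-unique F²
        (hasSize-map (×-setoid setoid F²) F² proj₂ proj₂
          (λ (γ , st) ((_ , γ≉0) , (st∈K , f≈γ)) → st∈K , λ f≈0 → γ≉0 (trans (sym f≈γ) f≈0))
          (λ (γ , s , t) (γ′ , s′ , t′) (_ , _ , f≈γ) (_ , _ , f≈γ′) (s≈ , t≈) →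
             trans (sym f≈γ) (trans (suzuki-cong s≈ t≈) f≈γ′) , s≈ , t≈)
          (λ (s , t) ((s∈K , t∈K) , f≉0) → (suzuki (s , t) , s , t) ,
             ((suzuki∈K s∈K t∈K , f≉0) , (s∈K , t∈K) , refl) , refl , refl)
          (hasSize-Σ setoid F² (λ { _ γ≈ (st∈K , f≈γ) → st∈K , trans f≈γ γ≈ })
            (hasSize-∖ setoid {P = _≈ 0#} (λ x≈y x≈0 → trans (sym x≈y) x≈0) (_≟ 0#) K-size
              (hasSize-1 setoid 0# (0∈K , refl) (λ _ → proj₂)))
            (λ γ (γ∈K , γ≉0) → fibre-m γ∈K γ≉0)))
        (hasSize-∖ F² fibre-resp (λ x → suzuki x ≟ 0#) K²-size fibre-0-size))

    fibre-size : ∀ {γ} → γ ∈K → γ ≉ 0# → HasSize F² (Fibre γ) (q ℕ.+ 1)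
    fibre-size γ∈K γ≉0 = ≡.subst (HasSize F² _) m≡q+1 (fibre-m γ∈K γ≉0)

-- Adding a linear functional to the ovoid, and sums of two such functions.

module OvoidSections {c ℓ} (e k : ℕ) (k+1+k≡e : k ℕ.+ suc k ≡ e) (F : FiniteField c ℓ ((2 ℕ.^ e) ℕ.^ 2))
  (ε : FiniteField.Carrier F) (ε^q≈ε+1 : QuadraticExtension.EpsilonConjugate e F ε) where

  open FiniteField F hiding (zero) renaming (_≟_ to infix 4 _≟_)
  open FiniteFieldProperties F
  open QuadraticExtension e F
  open SuzukiOvoid e k k+1+k≡e F ε
  open Coordinates ε ε^q≈ε+1
  open SetoidReasoning setoid
  open 𝔽₂-Solver using (solve; _:+_; _:*_; _:=_; con)

  Γ′ : Carrier → Carrier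
  Γ′ x = suzuki (re x , Tr x)

  -- Retains of Γ′ only the distribution of its values, which is all that counting the solutions of
  -- g₁ x + g₂ y = γ requires. The exceptional value κ depends on the functional that is added.
  record Ovoidal (g : Carrier → Carrier) : Set (c ⊔ ℓ) where
    field
      g-cong           : ∀ {x y} → x ≈ y → g x ≈ g y
      g∈K              : ∀ x → g x ∈K
      κ                : Carrier
      κ∈K              : κ ∈K
      special-fibre    : HasSize setoid (λ x → g x ≈ κ) 1
      ordinary-fibre   : ∀ {γ} → γ ∈K → ¬ γ ≈ κ → HasSize setoid (λ x → g x ≈ γ) (q ℕ.+ 1)

  -- The translations of suzuki-translate absorb any linear functional into the ovoid.
  ovoidal-+linear : ∀ a → Ovoidal (λ x → Tr (a * x) + Γ′ x)
  ovoidal-+linear a = record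
    { g-cong         = λ x≈y → +-cong (Tr-cong (*-congˡ x≈y)) (suzuki-cong (re-cong x≈y) (Tr-cong x≈y))
    ; g∈K            = λ x → +∈K (Tr∈K _) (suzuki∈K (re∈K x) (Tr∈K x))
    ; κ              = κ
    ; κ∈K            = κ∈K
    ; special-fibre  = hasSize-via (hasSize-⇔ F²
        (λ _ (st∈K , f≈0) → st∈K , trans f≈0 (sym (x+x≈0 κ)))
        (λ _ (st∈K , f≈) → st∈K , trans f≈ (x+x≈0 κ))
        (fibre-0-size ε^q≈ε+1))
    ; ordinary-fibre = λ γ∈K γ≉κ → hasSize-via (fibre-size ε^q≈ε+1 (+∈K γ∈K κ∈K) (λ γ+κ≈0 → γ≉κ (x+y≈0⇒x≈y γ+κ≈0)))
    }
    where
    α = Tr a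
    β = Tr (a * ε)
    -- u and v solve u = β and v + φ(u) u = α, so the linear part in `suzuki-translate` becomes α s
    -- + β t; the constant left over is κ.
    u = β
    v = α + φ u * u
    κ = suzuki (u , v)
    u∈K : u ∈K
    u∈K = Tr∈K _
    φu∈K : φ u ∈K
    φu∈K = frob∈K (suc k) u∈K
    v∈K : v ∈K
    v∈K = +∈K (Tr∈K a) (*∈K φu∈K u∈K)
    κ∈K = suzuki∈K u∈K v∈K
    g : Carrier → Carrier
    g x = Tr (a * x) + Γ′ x
    functional : ∀ x → Tr (a * x) ≈ α * re x + β * Tr x
    functional x = begin
      Tr (a * x)                           ≈⟨ Tr-cong (*-congˡ (re-Tr x)) ⟨
      Tr (a * (re x + Tr x * ε))
        ≈⟨ Tr-cong (solve 4 (λ a s t ε → a :* (s :+ t :* ε) := a :* s :+ a :* ε :* t) refl a (re x) (Tr x) ε) ⟩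
      Tr (a * re x + a * ε * Tr x)         ≈⟨ Tr-+ _ _ ⟩
      Tr (a * re x) + Tr (a * ε * Tr x)    ≈⟨ +-cong (Tr-* a (re∈K x)) (Tr-* (a * ε) (Tr∈K x)) ⟩
      α * re x + β * Tr x                  ∎
    shift : Carrier × Carrier → Carrier × Carrier
    shift (s , t) = s + u , t + (φ u * s + v)
    unshift : Carrier × Carrier → Carrier × Carrier
    unshift (s , t) = s + u , t + (φ u * (s + u) + v)
    g≈shift : ∀ x → g x ≈ suzuki (shift (re x , Tr x)) + κ
    g≈shift x = begin
      Tr (a * x) + Γ′ x                    ≈⟨ +-congʳ (functional x) ⟩
      α * re x + β * Tr x + Γ′ x
        -- Terms added twice are zero: w + w brings in v + φ(u) u in place of α, and k + k supplies
        -- one κ for the translated form and one that remains outside.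
        ≈⟨ solve 7 (λ α β s t f k w → α :* s :+ β :* t :+ f := f :+ ((α :+ w :+ w) :* s :+ β :* t) :+ k :+ k)
             refl α β (re x) (Tr x) (Γ′ x) κ (φ u * u) ⟩
      Γ′ x + ((v + φ u * u) * re x + u * Tr x) + κ + κ ≈⟨ +-congʳ (suzuki-translate v (re x) (Tr x) u∈K) ⟨
      suzuki (shift (re x , Tr x)) + κ           ∎
    shift-unshift : ∀ s t → Setoid._≈_ F² (shift (unshift (s , t))) (s , t)
    shift-unshift s t = x+y+y≈x s u ,
      solve 5 (λ s t u v w → t :+ (w :* (s :+ u) :+ v) :+ (w :* (s :+ u) :+ v) := t) refl s t u v (φ u)
    unshift-shift : ∀ s t → Setoid._≈_ F² (unshift (shift (s , t))) (s , t)
    unshift-shift s t = x+y+y≈x s u ,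
      solve 5 (λ s t u v w → t :+ (w :* s :+ v) :+ (w :* (s :+ u :+ u) :+ v) := t) refl s t u v (φ u)
    shift-cong : ∀ {s s′ t t′} → s ≈ s′ → t ≈ t′ → Setoid._≈_ F² (shift (s , t)) (shift (s′ , t′))
    shift-cong s≈ t≈ = +-congʳ s≈ , +-cong t≈ (+-congʳ (*-congˡ s≈))
    unshift-cong : ∀ {s s′ t t′} → s ≈ s′ → t ≈ t′ → Setoid._≈_ F² (unshift (s , t)) (unshift (s′ , t′))
    unshift-cong s≈ t≈ = +-congʳ s≈ , +-cong t≈ (+-congʳ (*-congˡ (+-congʳ s≈)))
    point : Carrier × Carrier → Carrier
    point (s , t) = s + t * ε
    unshift∈K : ∀ {s t} → s ∈K → t ∈K → K² (unshift (s , t))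
    unshift∈K s∈K t∈K = +∈K s∈K u∈K , +∈K t∈K (+∈K (*∈K φu∈K (+∈K s∈K u∈K)) v∈K)
    shift∈K : ∀ {s t} → s ∈K → t ∈K → K² (shift (s , t))
    shift∈K s∈K t∈K = +∈K s∈K u∈K , +∈K t∈K (+∈K (*∈K φu∈K s∈K) v∈K)
    shift-point : ∀ {s t} → s ∈K → t ∈K →
      Setoid._≈_ F² (shift (re (point (unshift (s , t))) , Tr (point (unshift (s , t))))) (s , t)
    shift-point {s} {t} s∈K t∈K =
      let s′∈K , t′∈K = unshift∈K s∈K t∈K in
      Setoid.trans F² (shift-cong (re-coordinates s′∈K t′∈K) (Tr-coordinates s′∈K t′∈K)) (shift-unshift s t)
    -- By `g≈shift`, g takes the value γ exactly where the translated Suzuki form takes γ + κ.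
    hasSize-via : ∀ {γ n} → HasSize F² (Fibre ε^q≈ε+1 (γ + κ)) n → HasSize setoid (λ x → g x ≈ γ) n
    hasSize-via {γ} = hasSize-map F² setoid (point ∘ unshift)
      (λ (s≈ , t≈) → let s′≈ , t′≈ = unshift-cong s≈ t≈ in +-cong s′≈ (*-congʳ t′≈))
      (λ (s , t) ((s∈K , t∈K) , f≈) → let s≈ , t≈ = shift-point s∈K t∈K in begin
         g (point (unshift (s , t)))  ≈⟨ g≈shift _ ⟩
         suzuki (shift (re (point (unshift (s , t))) , Tr (point (unshift (s , t))))) + κ ≈⟨ +-congʳ (suzuki-cong s≈ t≈) ⟩
         suzuki (s , t) + κ           ≈⟨ +-congʳ f≈ ⟩
         γ + κ + κ                    ≈⟨ x+y+y≈x γ κ ⟩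
         γ                            ∎)
      (λ (s , t) (s′ , t′) ((s∈K , t∈K) , _) ((s′∈K , t′∈K) , _) eq →
         Setoid.trans F² (Setoid.sym F² (shift-point s∈K t∈K))
           (Setoid.trans F² (shift-cong (re-cong eq) (Tr-cong eq)) (shift-point s′∈K t′∈K)))
      (λ x gx≈γ → shift (re x , Tr x) ,
         (shift∈K (re∈K x) (Tr∈K x) ,
          trans (sym (x+y+y≈x _ κ)) (+-congʳ (trans (sym (g≈shift x)) gx≈γ))) ,
         (let s≈ , t≈ = unshift-shift (re x) (Tr x) in trans (sym (re-Tr x)) (+-cong (sym s≈) (*-congʳ (sym t≈)))))

  module _ {g₁ g₂} (O₁ : Ovoidal g₁) (O₂ : Ovoidal g₂) {γ} (γ∈K : γ ∈K) where
    private
      module O₁ = Ovoidal O₁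
      module O₂ = Ovoidal O₂

      -- For fixed x the solutions y form the fibre of g₂ over γ + g₁ x. It is a single point for
      -- the n arguments x with g₁ x = γ + κ₂ and has q + 1 points for all others.
      pairs-size : ∀ {n} → HasSize setoid (λ x → g₁ x ≈ γ + O₂.κ) n →
                   HasSize F² (λ (x , y) → g₁ x + g₂ y ≈ γ) (n ℕ.* 1 ℕ.+ (q ℕ.^ 2 ℕ.∸ n) ℕ.* (q ℕ.+ 1))
      pairs-size N = hasSize-⇔ F²
        (λ { (x , y) (inj₁ (g₁≈ , g₂≈)) → trans (+-cong g₁≈ g₂≈) (x+y+y≈x γ O₂.κ)
           ; (x , y) (inj₂ (_ , g₂≈)) → trans (+-congˡ g₂≈) (swap γ (g₁ x)) })
        (λ (x , y) g≈ → case g₁ x ≟ γ + O₂.κ of λ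
           { (yes g₁≈) → inj₁ (g₁≈ , trans (solve₂ g≈) (trans (+-congˡ g₁≈) (cancel γ O₂.κ)))
           ; (no g₁≉)  → inj₂ ((_ , g₁≉) , solve₂ g≈) })
        (hasSize-∪ F²
          (λ _ _ (g₁≈ , _) ((_ , g₁≉) , _) (x≈ , _) → g₁≉ (trans (O₁.g-cong (sym x≈)) g₁≈))
          (hasSize-Σ setoid setoid (λ _ _ g₂≈ → g₂≈) N (λ _ _ → O₂.special-fibre))
          (hasSize-Σ setoid setoid (λ _ x≈ g₂≈ → trans g₂≈ (+-congˡ (O₁.g-cong x≈)))
            (hasSize-∖ setoid (λ x≈y g₁≈ → trans (O₁.g-cong (sym x≈y)) g₁≈) (λ x → g₁ x ≟ γ + O₂.κ) size
              (hasSize-⇔ setoid (λ _ → _ ,_) (λ _ → proj₂) N))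
            (λ x (_ , g₁≉) → O₂.ordinary-fibre (+∈K γ∈K (O₁.g∈K x))
              (λ γ+g₁≈κ → g₁≉ (trans (sym (cancel γ (g₁ x))) (+-congˡ γ+g₁≈κ))))))
        where
        swap : ∀ x y → y + (x + y) ≈ x
        swap = solve 2 (λ x y → y :+ (x :+ y) := x) refl
        cancel : ∀ x y → x + (x + y) ≈ y
        cancel = solve 2 (λ x y → x :+ (x :+ y) := y) refl
        solve₂ : ∀ {x y} → x + y ≈ γ → y ≈ γ + x
        solve₂ {x} {y} x+y≈γ = trans (sym (swap y x)) (trans (+-comm _ _) (+-congʳ (trans (+-comm y x) x+y≈γ)))

    -- The alternative is whether γ + κ₂ is the exceptional value of g₁, so that its fibre has 1 or
    -- q + 1 points.
    ovoidal-sum-size : HasSize F² (λ (x , y) → g₁ x + g₂ y ≈ γ) (1 ℕ.* 1 ℕ.+ (q ℕ.^ 2 ℕ.∸ 1) ℕ.* (q ℕ.+ 1)) ⊎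
                       HasSize F² (λ (x , y) → g₁ x + g₂ y ≈ γ) ((q ℕ.+ 1) ℕ.* 1 ℕ.+ (q ℕ.^ 2 ℕ.∸ (q ℕ.+ 1)) ℕ.* (q ℕ.+ 1))
    ovoidal-sum-size with γ + O₂.κ ≟ O₁.κ
    ... | yes γ+κ₂≈κ₁ = inj₁ (pairs-size (hasSize-⇔ setoid
            (λ _ g₁≈ → trans g₁≈ (sym γ+κ₂≈κ₁)) (λ _ g₁≈ → trans g₁≈ γ+κ₂≈κ₁) O₁.special-fibre))
    ... | no  γ+κ₂≉κ₁ = inj₂ (pairs-size (O₁.ordinary-fibre (+∈K γ∈K O₂.κ∈K) γ+κ₂≉κ₁))

-- Homogenization of formal polynomials and its evaluation.

+-∸-interchange : ∀ {a b} m n → a ℕ.≤ m → b ℕ.≤ n → (m ℕ.+ n) ∸ (a ℕ.+ b) ≡ (m ∸ a) ℕ.+ (n ∸ b)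
+-∸-interchange {a} {b} m n a≤m b≤n = ≡.trans (≡.sym (ℕ.∸-+-assoc (m ℕ.+ n) a b))
  (≡.trans (≡.cong (_∸ b) (ℕ.+-∸-comm n a≤m)) (ℕ.+-∸-assoc (m ∸ a) b≤n))

sum-zipWith-+ : ∀ {k} (α β : Vec ℕ k) → Vec.sum (Vec.zipWith ℕ._+_ α β) ≡ Vec.sum α ℕ.+ Vec.sum β
sum-zipWith-+ []      []      = ≡.refl
sum-zipWith-+ (a ∷ α) (b ∷ β) = ≡.trans (≡.cong (a ℕ.+ b ℕ.+_) (sum-zipWith-+ α β)) (+-interchange a b (Vec.sum α) (Vec.sum β))
  where open CommutativeSemigroup ℕ.+-commutativeSemigroup using () renaming (interchange to +-interchange)

sum-zeros : ∀ k → Vec.sum (Vec.replicate k 0) ≡ 0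
sum-zeros zero    = ≡.refl
sum-zeros (suc k) = sum-zeros k

sum-unit : ∀ {k} (i : Fin k) → Vec.sum (Vec.updateAt (Vec.replicate k 0) i (λ _ → 1)) ≡ 1
sum-unit {suc k} zero    = ≡.cong suc (sum-zeros k)
sum-unit {suc k} (suc i) = sum-unit i

∈⇒≤⊔ : ∀ {n} {ns : List ℕ} → n ∈ ns → n ℕ.≤ List.foldr ℕ._⊔_ 0 ns
∈⇒≤⊔ (here ≡.refl) = ℕ.m≤m⊔n _ _
∈⇒≤⊔ (there n∈ns)  = ℕ.≤-trans (∈⇒≤⊔ n∈ns) (ℕ.m≤n⊔m _ _)

⊔≤ : ∀ {n} {ns : List ℕ} → All (ℕ._≤ n) ns → List.foldr ℕ._⊔_ 0 ns ℕ.≤ n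
⊔≤ []              = ℕ.z≤n
⊔≤ (m≤n ∷ ms≤n) = ℕ.⊔-lub m≤n (⊔≤ ms≤n)

module Homogenization {c ℓ n} (F : FiniteField c ℓ n) where

  open FiniteField F hiding (zero) renaming (_≟_ to infix 4 _≟_)
  open FiniteFieldProperties F
  open RingProperties ring using (-‿distribˡ-*; -‿+-comm; -0#≈0#)
  open OverField F
  open Exp commutativeSemiring
  open RawSemiringDefs (Semiring.rawSemiring semiring) using (product)
  open CommutativeSemigroup *-commutativeSemigroup using () renaming (interchange to *-interchange; x∙yz≈y∙xz to x*yz≈y*xz)
  open SetoidReasoning setoid
  private
    module P {k} = RawSemiringDefs (RawRing.rawSemiring (polyRing k))
    module R {k} = RawRing (polyRing k)

  0^suc : ∀ {x} d → x ≈ 0# → x ^ suc d ≈ 0#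
  0^suc d x≈0 = trans (*-congʳ x≈0) (zeroˡ _)

  1^ : ∀ d → 1# ^ d ≈ 1#
  1^ zero    = refl
  1^ (suc d) = trans (*-identityˡ _) (1^ d)

  monomial : ∀ {k} → Vector Carrier k → Vec ℕ k → Carrier
  monomial v α = product (λ i → v i ^ Vec.lookup α i)

  monomial-+ : ∀ {k} (v : Vector Carrier k) α β → monomial v (Vec.zipWith ℕ._+_ α β) ≈ monomial v α * monomial v β
  monomial-+ v []      []      = sym (*-identityˡ 1#)
  monomial-+ v (a ∷ α) (b ∷ β) = trans (*-cong (^-homo-* (v zero) a b) (monomial-+ (v ∘ suc) α β)) (*-interchange _ _ _ _)

  monomial-zeros : ∀ {k} (v : Vector Carrier k) → monomial v (Vec.replicate k 0) ≈ 1#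
  monomial-zeros {zero}  v = refl
  monomial-zeros {suc k} v = trans (*-identityˡ _) (monomial-zeros (v ∘ suc))

  monomial-unit : ∀ {k} (v : Vector Carrier k) i → monomial v (Vec.updateAt (Vec.replicate k 0) i (λ _ → 1)) ≈ v i
  monomial-unit {suc k} v zero    = trans (*-cong (*-identityʳ _) (monomial-zeros (v ∘ suc))) (*-identityʳ _)
  monomial-unit {suc k} v (suc i) = trans (*-identityˡ _) (monomial-unit (v ∘ suc) i)

  monomial-scale : ∀ {k} {v w : Vector Carrier k} a → (∀ i → v i ≈ a * w i) → ∀ α → monomial v α ≈ a ^ Vec.sum α * monomial w α
  monomial-scale a v≈aw []      = sym (*-identityˡ 1#)
  monomial-scale {v = v} {w} a v≈aw (b ∷ α) = begin
    v zero ^ b * monomial (v ∘ suc) α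
      ≈⟨ *-cong (trans (^-congˡ b (v≈aw zero)) (^-distrib-* a (w zero) b)) (monomial-scale a (v≈aw ∘ suc) α) ⟩
    a ^ b * w zero ^ b * (a ^ Vec.sum α * monomial (w ∘ suc) α)  ≈⟨ *-interchange _ _ _ _ ⟩
    a ^ b * a ^ Vec.sum α * monomial w (b ∷ α)                   ≈⟨ *-congʳ (^-homo-* a b (Vec.sum α)) ⟨
    a ^ (b ℕ.+ Vec.sum α) * monomial w (b ∷ α)                   ∎

  -- Bounds every listed term, including terms whose coefficients cancel. Unlike `degree`, it is
  -- therefore compatible with concatenation and products of lists.
  Bounded : ∀ {k} → ℕ → Poly k → Set c
  Bounded D f = All (λ (a , α) → Vec.sum α ℕ.≤ D) f

  -- `homogenize` with the target degree as a parameter, so that summands of different degrees can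
  -- be brought to a common one. The two agree for D = `degree f`.
  homogenizeTo : ∀ {k} → ℕ → Poly k → Poly (suc k)
  homogenizeTo D f = List.map (λ (a , α) → a , (D ∸ Vec.sum α) Vec.∷ α) f

  evalTo : ∀ {k} → ℕ → Poly k → Vector Carrier (suc k) → Carrier
  evalTo D f X = eval (homogenizeTo D f) X

  -- The bound keeps D ∸ |α| from truncating, so each homogenized monomial has total degree exactly
  -- D.
  evalTo-scale : ∀ {k D} {f : Poly k} {X Y} a → Bounded D f → (∀ i → X i ≈ a * Y i) → evalTo D f X ≈ a ^ D * evalTo D f Y
  evalTo-scale a [] X≈aY = sym (zeroʳ _)
  evalTo-scale {D = D} {(b , α) ∷ f} {X} {Y} a (α≤D ∷ f≤D) X≈aY = begin
    b * monomial X α₊ + evalTo D f X   ≈⟨ +-cong (*-congˡ (monomial-scale a X≈aY α₊)) (evalTo-scale a f≤D X≈aY) ⟩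
    b * (a ^ (D ∸ Vec.sum α ℕ.+ Vec.sum α) * monomial Y α₊) + a ^ D * evalTo D f Y
      ≈⟨ +-congʳ (trans (x*yz≈y*xz b _ _) (*-congʳ (^-congʳ a (ℕ.m∸n+n≡m α≤D)))) ⟩
    a ^ D * (b * monomial Y α₊) + a ^ D * evalTo D f Y   ≈⟨ distribˡ _ _ _ ⟨
    a ^ D * (b * monomial Y α₊ + evalTo D f Y)           ∎
    where α₊ = (D ∸ Vec.sum α) Vec.∷ α

  module _ {k} (X : Vector Carrier (suc k)) where
    private
      z = X zero
      x = X ∘ suc

    -- f has degree at most D, and its homogenization to degree D takes the value h at X.
    Value : ℕ → Poly k → Carrier → Set _
    Value D f h = Bounded D f × evalTo D f X ≈ h

    private
      evalTo-++ : ∀ D f g → evalTo D (f ++ g) X ≈ evalTo D f X + evalTo D g X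
      evalTo-++ D []      g = sym (+-identityˡ _)
      evalTo-++ D (t ∷ f) g = trans (+-congˡ (evalTo-++ D f g)) (sym (+-assoc _ _ _))

      monomial-∷-+ : ∀ D D′ {α β : Vec ℕ k} → Vec.sum α ℕ.≤ D → Vec.sum β ℕ.≤ D′ →
        monomial X ((D ℕ.+ D′ ∸ Vec.sum (Vec.zipWith ℕ._+_ α β)) ∷ Vec.zipWith ℕ._+_ α β) ≈
        monomial X ((D ∸ Vec.sum α) ∷ α) * monomial X ((D′ ∸ Vec.sum β) ∷ β)
      monomial-∷-+ D D′ {α} {β} α≤D β≤D′ = begin
        z ^ (D ℕ.+ D′ ∸ Vec.sum (Vec.zipWith ℕ._+_ α β)) * monomial x (Vec.zipWith ℕ._+_ α β)
          ≈⟨ *-cong (^-congʳ z (≡.trans (≡.cong (D ℕ.+ D′ ∸_) (sum-zipWith-+ α β)) (+-∸-interchange D D′ α≤D β≤D′)))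
                    (monomial-+ x α β) ⟩
        z ^ (D ∸ Vec.sum α ℕ.+ (D′ ∸ Vec.sum β)) * (monomial x α * monomial x β)
          ≈⟨ *-congʳ (^-homo-* z (D ∸ Vec.sum α) _) ⟩
        z ^ (D ∸ Vec.sum α) * z ^ (D′ ∸ Vec.sum β) * (monomial x α * monomial x β)
          ≈⟨ *-interchange _ _ _ _ ⟩
        monomial X ((D ∸ Vec.sum α) ∷ α) * monomial X ((D′ ∸ Vec.sum β) ∷ β) ∎

      evalTo-term : ∀ D D′ {a} {α : Vec ℕ k} {g} → Vec.sum α ℕ.≤ D → Bounded D′ g →
        evalTo (D ℕ.+ D′) (List.map (λ (b , β) → a * b , Vec.zipWith ℕ._+_ α β) g) X ≈
        a * monomial X ((D ∸ Vec.sum α) ∷ α) * evalTo D′ g X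
      evalTo-term D D′ α≤D [] = sym (zeroʳ _)
      evalTo-term D D′ {a} {α} {(b , β) ∷ g} α≤D (β≤D′ ∷ g≤D′) = begin
        _   ≈⟨ +-cong (*-congˡ (monomial-∷-+ D D′ {α} {β} α≤D β≤D′)) (evalTo-term D D′ {α = α} α≤D g≤D′) ⟩
        a * b * (mα * mβ) + a * mα * evalTo D′ g X     ≈⟨ +-congʳ (*-interchange a b mα mβ) ⟩
        a * mα * (b * mβ) + a * mα * evalTo D′ g X     ≈⟨ distribˡ _ _ _ ⟨
        a * mα * (b * mβ + evalTo D′ g X)              ∎
        where
        mα = monomial X ((D ∸ Vec.sum α) ∷ α)
        mβ = monomial X ((D′ ∸ Vec.sum β) ∷ β)

      evalTo-* : ∀ D D′ {f g} → Bounded D f → Bounded D′ g → evalTo (D ℕ.+ D′) (f R.* g) X ≈ evalTo D f X * evalTo D′ g X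
      evalTo-* D D′ [] g≤D′ = sym (zeroˡ _)
      evalTo-* D D′ {(a , α) ∷ f} {g} (α≤D ∷ f≤D) g≤D′ = begin
        _  ≈⟨ evalTo-++ (D ℕ.+ D′) (List.map (λ (b , β) → a * b , Vec.zipWith ℕ._+_ α β) g) (f R.* g) ⟩
        _  ≈⟨ +-cong (evalTo-term D D′ {α = α} α≤D g≤D′) (evalTo-* D D′ f≤D g≤D′) ⟩
        _  ≈⟨ distribʳ _ _ _ ⟨
        _  ∎

      bounded-* : ∀ D D′ {f g : Poly k} → Bounded D f → Bounded D′ g → Bounded (D ℕ.+ D′) (f R.* g)
      bounded-* D D′ [] g≤D′ = []
      bounded-* D D′ {(a , α) ∷ f} (α≤D ∷ f≤D) g≤D′ = All.++⁺
        (All.map⁺ (All.map (λ {(b , β)} β≤D′ → ℕ.≤-trans (ℕ.≤-reflexive (sum-zipWith-+ α β)) (ℕ.+-mono-≤ α≤D β≤D′)) g≤D′))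
        (bounded-* D D′ f≤D g≤D′)

      evalTo-raise : ∀ {D D′} → D ℕ.≤ D′ → ∀ {f} → Bounded D f → evalTo D′ f X ≈ z ^ (D′ ∸ D) * evalTo D f X
      evalTo-raise D≤D′ [] = sym (zeroʳ _)
      evalTo-raise {D} {D′} D≤D′ {(a , α) ∷ f} (α≤D ∷ f≤D) = begin
        a * (z ^ (D′ ∸ Vec.sum α) * monomial x α) + evalTo D′ f X
          ≈⟨ +-cong (*-congˡ (*-congʳ (^-congʳ z split))) (evalTo-raise D≤D′ f≤D) ⟩
        a * (z ^ (D′ ∸ D ℕ.+ (D ∸ Vec.sum α)) * monomial x α) + d * evalTo D f X
          ≈⟨ +-congʳ (*-congˡ (trans (*-congʳ (^-homo-* z (D′ ∸ D) _)) (*-assoc _ _ _))) ⟩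
        a * (d * (z ^ (D ∸ Vec.sum α) * monomial x α)) + d * evalTo D f X ≈⟨ +-congʳ (x*yz≈y*xz a d _) ⟩
        d * (a * (z ^ (D ∸ Vec.sum α) * monomial x α)) + d * evalTo D f X ≈⟨ distribˡ _ _ _ ⟨
        d * (a * (z ^ (D ∸ Vec.sum α) * monomial x α) + evalTo D f X)     ∎
        where
        d = z ^ (D′ ∸ D)
        split : D′ ∸ Vec.sum α ≡ D′ ∸ D ℕ.+ (D ∸ Vec.sum α)
        split = ≡.trans (≡.cong (_∸ Vec.sum α) (≡.sym (ℕ.m∸n+n≡m D≤D′))) (ℕ.+-∸-assoc (D′ ∸ D) α≤D)

      evalTo-neg : ∀ D f → evalTo D (R.- f) X ≈ - evalTo D f X
      evalTo-neg D []            = sym -0#≈0#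
      evalTo-neg D ((a , α) ∷ f) = trans (+-cong (sym (-‿distribˡ-* a _)) (evalTo-neg D f)) (-‿+-comm _ _)

    value-+ : ∀ {D f g a b} → Value D f a → Value D g b → Value D (f R.+ g) (a + b)
    value-+ {f = f} {g} (f≤D , f≈a) (g≤D , g≈b) = All.++⁺ f≤D g≤D , trans (evalTo-++ _ f g) (+-cong f≈a g≈b)

    value-* : ∀ {D D′ f g a b} → Value D f a → Value D′ g b → Value (D ℕ.+ D′) (f R.* g) (a * b)
    value-* (f≤D , f≈a) (g≤D′ , g≈b) = bounded-* _ _ f≤D g≤D′ , trans (evalTo-* _ _ f≤D g≤D′) (*-cong f≈a g≈b)

    value-neg : ∀ {D f a} → Value D f a → Value D (R.- f) (- a)
    value-neg {f = f} (f≤D , f≈a) = All.map⁺ f≤D , trans (evalTo-neg _ f) (-‿cong f≈a)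

    value-[] : ∀ {D} → Value D [] 0#
    value-[] = [] , refl

    value-const : ∀ a → Value 0 (const a) a
    value-const a = ℕ.≤-reflexive (sum-zeros k) ∷ [] ,
      trans (+-identityʳ _) (trans (*-congˡ (trans (*-congˡ (monomial-zeros x))
        (trans (*-identityʳ _) (^-congʳ z (ℕ.0∸n≡0 (Vec.sum (Vec.replicate k 0))))))) (*-identityʳ a))

    value-var : ∀ i → Value 1 (var i) (X (suc i))
    value-var i = ℕ.≤-reflexive (sum-unit i) ∷ [] ,
      trans (+-identityʳ _) (trans (*-identityˡ _) (trans (*-cong (^-congʳ z (≡.cong (1 ∸_) (sum-unit i))) (monomial-unit x i)) (*-identityˡ _)))

    value-^ : ∀ {D f a} → Value D f a → ∀ m → Value (m ℕ.* D) (f P.^ m) (a ^ m)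
    value-^ f∶a zero    = value-const 1#
    value-^ f∶a (suc m) = value-* f∶a (value-^ f∶a m)

    value-≡ : ∀ {D D′ f a} → D ≡ D′ → Value D f a → Value D′ f a
    value-≡ ≡.refl f∶a = f∶a

    -- For z * z ≈ z the power of z gained by raising the degree is z, so z = 1 (affine points)
    -- and z = 0 (points at infinity) are treated by the same computation.
    value-raise : ∀ {D D′ f a} → z * z ≈ z → D ℕ.< D′ → Value D f a → Value D′ f (z * a)
    value-raise {D} {D′} zz≈z D<D′ (f≤D , f≈a) =
      All.map (λ α≤D → ℕ.≤-trans α≤D D≤D′) f≤D , trans (evalTo-raise D≤D′ f≤D) (*-cong (z^≈z _ (ℕ.m<n⇒0<n∸m D<D′)) f≈a)
      where
      D≤D′ = ℕ.<⇒≤ D<D′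
      z^≈z : ∀ d → 0 ℕ.< d → z ^ d ≈ z
      z^≈z (suc zero)    _ = *-identityʳ z
      z^≈z (suc (suc d)) _ = trans (*-congˡ (z^≈z (suc d) (ℕ.s≤s ℕ.z≤n))) zz≈z

  e₁ : ∀ {k} → Vector Carrier (suc (suc k))
  e₁ zero          = 0#
  e₁ (suc zero)    = 1#
  e₁ (suc (suc _)) = 0#

  private
    monomial-0ˢ : ∀ {k} (β : Vec ℕ k) → ¬ β ≡ Vec.replicate k 0 → monomial (λ _ → 0#) β ≈ 0#
    monomial-0ˢ []          β≢0 = ⊥-elim (β≢0 ≡.refl)
    monomial-0ˢ (zero ∷ β)  β≢0 = trans (*-identityˡ _) (monomial-0ˢ β (β≢0 ∘ ≡.cong (0 ∷_)))
    monomial-0ˢ (suc b ∷ β) β≢0 = trans (*-congʳ (0^suc b refl)) (zeroˡ _)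

    pure-power : ∀ k D → Vec.sum {n = suc k} (D ∷ Vec.replicate k 0) ≡ D
    pure-power k D = ≡.trans (≡.cong (D ℕ.+_) (sum-zeros k)) (ℕ.+-identityʳ D)

  -- At (0 : 1 : 0 : … : 0) every monomial of degree D vanishes except the power of the first variable.
  coeff-pure-power : ∀ {k} D (f : Poly (suc k)) → Bounded D f → coeff f (D ∷ Vec.replicate k 0) ≈ evalTo D f e₁
  coeff-pure-power D [] [] = refl
  coeff-pure-power {k} D ((a , β) ∷ f) (β≤D ∷ f≤D) = +-cong (term (Vec.≡-dec ℕ._≟_ β α)) (coeff-pure-power D f f≤D)
    where
    α = D ∷ Vec.replicate k 0
    other : ∀ {b} (β′ : Vec ℕ k) → ¬ b ∷ β′ ≡ α → b ℕ.+ Vec.sum β′ ℕ.≤ D →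
            monomial e₁ ((D ∸ (b ℕ.+ Vec.sum β′)) ∷ b ∷ β′) ≈ 0#
    other {b} β′ β≢α β≤D with Vec.≡-dec ℕ._≟_ β′ (Vec.replicate k 0)
    ... | no β′≢0    = trans (*-congˡ (trans (*-congˡ (monomial-0ˢ β′ β′≢0)) (zeroʳ _))) (zeroʳ _)
    ... | yes ≡.refl with D ∸ (b ℕ.+ Vec.sum (Vec.replicate k 0)) in eq
    ...   | suc d = trans (*-congʳ (0^suc d refl)) (zeroˡ _)
    ...   | zero  = ⊥-elim (β≢α (≡.cong (_∷ _) (ℕ.≤-antisym
              (≡.subst (ℕ._≤ D) (pure-power k b) β≤D) (≡.subst (D ℕ.≤_) (pure-power k b) (ℕ.m∸n≡0⇒m≤n eq)))))
    term : (d : Dec (β ≡ α)) → (if does d then a else 0#) ≈ a * monomial e₁ ((D ∸ Vec.sum β) ∷ β)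
    term (yes ≡.refl) = sym (begin
      a * (0# ^ (D ∸ Vec.sum α) * (1# ^ D * monomial (λ _ → 0#) (Vec.replicate k 0)))
        ≈⟨ *-congˡ (*-cong (^-congʳ 0# (≡.trans (≡.cong (D ∸_) (pure-power k D)) (ℕ.n∸n≡0 D)))
             (*-cong (1^ D) (monomial-zeros {k} (λ _ → 0#)))) ⟩
      a * (1# * (1# * 1#))  ≈⟨ trans (*-congˡ (trans (*-identityˡ _) (*-identityˡ 1#))) (*-identityʳ a) ⟩
      a                     ∎)
    term (no β≢α) = sym (trans (*-congˡ (go β β≢α β≤D)) (zeroʳ a))
      where
      go : ∀ β → ¬ β ≡ α → Vec.sum β ℕ.≤ D → monomial e₁ ((D ∸ Vec.sum β) ∷ β) ≈ 0#
      go (b ∷ β′) = other β′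

  coeff≉0⇒∈ : ∀ {k} (f : Poly k) α → coeff f α ≉ 0# → α ∈ List.map proj₂ f
  coeff≉0⇒∈ []            α ≉0 = ⊥-elim (≉0 refl)
  coeff≉0⇒∈ ((a , β) ∷ f) α ≉0 with Vec.≡-dec ℕ._≟_ β α
  ... | yes ≡.refl = here ≡.refl
  ... | no  _      = there (coeff≉0⇒∈ f α (λ ≈0 → ≉0 (trans (+-identityˡ _) ≈0)))

  -- The bound gives one inequality. For the other, the value at `e₁` is the coefficient of the D-th
  -- power of the first variable, so this power survives in f.
  degree-pure-power : ∀ {k} D (f : Poly (suc k)) → Bounded D f → evalTo D f e₁ ≉ 0# → degree f ≡ D
  degree-pure-power {k} D f f≤D ≉0 = ℕ.≤-antisym
    (⊔≤ (All.map⁺ (All.filter⁺ nonzero? (All.map⁺ f≤D))))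
    (≡.subst (ℕ._≤ degree f) (pure-power k D) (∈⇒≤⊔ (∈-map⁺ Vec.sum (∈-filter⁺ nonzero? (coeff≉0⇒∈ f α α≉0) α≉0))))
    where
    α = D ∷ Vec.replicate k 0
    nonzero? = λ β → ¬? (coeff f β ≟ 0#)
    α≉0 : coeff f α ≉ 0#
    α≉0 α≈0 = ≉0 (trans (sym (coeff-pure-power D f f≤D)) α≈0)

-- The equation of 𝒱: its degree, its affine points and its points at infinity.

private
  module _ where
    open ℕ.+-*-Solver using (solve; _:+_; _:*_; _:=_; con)

    <-from-+ : ∀ {m n} r → n ≡ suc (m ℕ.+ r) → m ℕ.< n
    <-from-+ r ≡.refl = ℕ.s≤s (ℕ.m≤m+n _ r)

    k+1+k+1≡ : ∀ k → k ℕ.+ suc k ℕ.+ 1 ≡ suc k ℕ.* 2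
    k+1+k+1≡ = solve 1 (λ k → k :+ (con 1 :+ k) :+ con 1 := (con 1 :+ k) :* con 2) ≡.refl

    4k+2≡ : ∀ k → k ℕ.+ k ℕ.+ (k ℕ.+ k) ℕ.+ 2 ≡ (k ℕ.+ suc k) ℕ.+ (k ℕ.+ suc k)
    4k+2≡ = solve 1 (λ k → k :+ k :+ (k :+ k) :+ con 2 := (k :+ (con 1 :+ k)) :+ (k :+ (con 1 :+ k))) ≡.refl

    -- This and the next two lemmas compare (x^q + x)^σ, (x^(2q) + x²) ε and x^(q+1) with the
    -- leading degree (σ + 2) q, where s stands for σ. The smaller degrees are spelled as `value-^`
    -- and `value-*` produce them.
    degree-T₂ : ∀ {s q} → 1 ℕ.≤ s → 2 ℕ.≤ q → s ℕ.* q ℕ.< (s ℕ.+ 2) ℕ.* q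
    degree-T₂ {suc s} {suc (suc p)} _ (ℕ.s≤s (ℕ.s≤s _)) = <-from-+ (3 ℕ.+ p ℕ.+ p)
      (solve 2 (λ s p → (con 1 :+ s :+ con 2) :* (con 2 :+ p) := con 1 :+ ((con 1 :+ s) :* (con 2 :+ p) :+ (con 3 :+ p :+ p))) ≡.refl s p)

    degree-T₃ : ∀ {s q} → 1 ℕ.≤ s → 2 ℕ.≤ q → 2 ℕ.* q ℕ.* 1 ℕ.+ 0 ℕ.< (s ℕ.+ 2) ℕ.* q
    degree-T₃ {suc s} {suc (suc p)} _ (ℕ.s≤s (ℕ.s≤s _)) = <-from-+ (1 ℕ.+ p ℕ.+ s ℕ.* (2 ℕ.+ p))
      (solve 2 (λ s p → (con 1 :+ s :+ con 2) :* (con 2 :+ p) := con 1 :+ (con 2 :* (con 2 :+ p) :* con 1 :+ con 0 :+ (con 1 :+ p :+ s :* (con 2 :+ p)))) ≡.refl s p)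

    degree-T₄ : ∀ {s q} → 1 ℕ.≤ s → 2 ℕ.≤ q → (q ℕ.+ 1) ℕ.* 1 ℕ.< (s ℕ.+ 2) ℕ.* q
    degree-T₄ {suc s} {suc (suc p)} _ (ℕ.s≤s (ℕ.s≤s _)) = <-from-+ (2 ℕ.+ p ℕ.+ p ℕ.+ s ℕ.* (2 ℕ.+ p))
      (solve 2 (λ s p → (con 1 :+ s :+ con 2) :* (con 2 :+ p) := con 1 :+ ((con 2 :+ p :+ con 1) :* con 1 :+ (con 2 :+ p :+ p :+ s :* (con 2 :+ p)))) ≡.refl s p)

    2<2q : ∀ {q} → 2 ℕ.≤ q → 2 ℕ.* 1 ℕ.< 2 ℕ.* q ℕ.* 1
    2<2q {q} 2≤q = ℕ.*-monoˡ-< 1 (ℕ.*-monoʳ-< 2 2≤q)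

module Variety {c ℓ} (e k : ℕ) (k+1+k≡e : k ℕ.+ suc k ≡ e) (F : FiniteField c ℓ ((2 ℕ.^ e) ℕ.^ 2))
  (ε : FiniteField.Carrier F) (ε^q≈ε+1 : QuadraticExtension.EpsilonConjugate e F ε) where

  open FiniteField F hiding (zero) renaming (_≟_ to infix 4 _≟_)
  open FiniteFieldProperties F
  open QuadraticExtension e F
  open SuzukiOvoid e k k+1+k≡e F ε
  open OvoidSections e k k+1+k≡e F ε ε^q≈ε+1
  open Coordinates ε ε^q≈ε+1
  open Homogenization F
  open OverField F
  open Exp commutativeSemiring
  open SetoidReasoning setoid
  open 𝔽₂-Solver using (solve; _:+_; _:*_; _:=_; con)

  σ≡ : σ e ≡ 2 ℕ.^ suc k
  σ≡ = ≡.cong (2 ℕ.^_) (≡.trans (≡.cong (_/ 2) e+1≡) (m*n/n≡m (suc k) 2))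
    where
    e+1≡ : e ℕ.+ 1 ≡ suc k ℕ.* 2
    e+1≡ = ≡.trans (≡.cong (ℕ._+ 1) (≡.sym k+1+k≡e)) (k+1+k+1≡ k)

  1≤σ : 1 ℕ.≤ σ e
  1≤σ = ≡.subst (1 ℕ.≤_) (≡.sym σ≡) (ℕ.m^n>0 2 (suc k))

  ^σ≈φ : ∀ x → x ^ σ e ≈ φ x
  ^σ≈φ x = ^-congʳ x σ≡

  ^[σ+2]≈ : ∀ x → x ^ (σ e ℕ.+ 2) ≈ φ x * (x * x)
  ^[σ+2]≈ x = trans (^-homo-* x (σ e) 2) (*-cong (^σ≈φ x) (frob-1 x))

  D : ℕ
  D = (σ e ℕ.+ 2) ℕ.* q

  equation : Poly 3
  equation = affineEquation e ε

  module _ (X : Vector Carrier 4) (zz≈z : X 0F * X 0F ≈ X 0F) where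
    private z = X 0F

    -- Γ homogenized to degree (σ + 2) q, with every positive power of z = X₀ replaced by z itself.
    Γ-value : Carrier → Carrier
    Γ-value x = (z * x + (x ^ q + z * x) * ε) ^ (σ e ℕ.+ 2) + z * (x ^ q + z * x) ^ σ e
              + z * ((x ^ (2 ℕ.* q) + z * x ^ 2) * ε) + z * x ^ (q ℕ.+ 1) + z * x ^ 2

    value-Γ : ∀ i → Value X D (Γ (polyRing 3) e (const ε) (var i)) (Γ-value (X (suc i)))
    value-Γ i = value-+ X (value-+ X (value-+ X (value-+ X
        (value-^ X (value-+ X (value-raise X zz≈z 2≤q x) (value-≡ X (ℕ.+-identityʳ q) (value-* X u (value-const X ε)))) (σ e ℕ.+ 2))
        (value-raise X zz≈z (degree-T₂ 1≤σ 2≤q) (value-^ X u (σ e))))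
        (value-raise X zz≈z (degree-T₃ 1≤σ 2≤q)
          (value-* X (value-+ X (value-^ X x (2 ℕ.* q)) (value-raise X zz≈z (2<2q 2≤q) (value-^ X x 2))) (value-const X ε))))
        (value-raise X zz≈z (degree-T₄ 1≤σ 2≤q) (value-^ X x (q ℕ.+ 1))))
        (value-raise X zz≈z (ℕ.≤-<-trans (ℕ.*-monoˡ-≤ 1 {2} {q ℕ.+ 1} (ℕ.m≤n⇒m≤n+o 1 2≤q)) (degree-T₄ 1≤σ 2≤q)) (value-^ X x 2))
      where
      x = value-var X i
      u = value-+ X (value-≡ X (ℕ.*-identityʳ q) (value-^ X x q)) (value-raise X zz≈z 2≤q x)

    value-equation : Value X D equation
      (z * X 3F ^ q + z * X 3F + - (Γ-value (X 1F) + (Γ-value (X 2F) + 0#)))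
    value-equation = value-+ X
      (value-+ X (value-raise X zz≈z q<D (value-≡ X (ℕ.*-identityʳ q) (value-^ X x q))) (value-raise X zz≈z (ℕ.<-trans 2≤q q<D) x))
      (value-neg X (value-+ X (value-Γ 0F) (value-+ X (value-Γ 1F) (value-[] X))))
      where
      x = value-var X 2F
      q<D : q ℕ.< D
      q<D = ℕ.≤-<-trans (ℕ.≤-trans (ℕ.m≤m+n q 1) (ℕ.≤-reflexive (≡.sym (ℕ.*-identityʳ (q ℕ.+ 1))))) (degree-T₄ 1≤σ 2≤q)

  Γ-value-affine : ∀ X zz≈z → X 0F ≈ 1# → ∀ x → Γ-value X zz≈z x ≈ Γ′ x
  Γ-value-affine X zz≈z z≈1 x = begin
    Γ-value X zz≈z x
      ≈⟨ +-cong (+-cong (+-cong (+-cong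
           (trans (^-congˡ (σ e ℕ.+ 2) (+-cong (1*≈ x) (*-congʳ u≈))) (^[σ+2]≈ (re x)))
           (trans (1*≈ _) (trans (^-congˡ (σ e) u≈) (^σ≈φ (Tr x)))))
           (trans (1*≈ _) (*-congʳ (+-cong (frob-suc e x) (trans (1*≈ _) (frob-1 x))))))
           (trans (1*≈ _) (trans (^-homo-* x q 1) (*-congˡ (*-identityʳ x)))))
           (trans (1*≈ _) (frob-1 x)) ⟩
    φ (re x) * (re x * re x) + φ (Tr x) + (frob e x * frob e x + x * x) * ε + frob e x * x + x * x
      -- With s = x + (x^q + x) ε and t = x^q + x, the last three terms of Γ combine to the product
      -- s t.
      ≈⟨ solve 5 (λ N T X x ε → N :+ T :+ (X :* X :+ x :* x) :* ε :+ X :* x :+ x :* x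
           := N :+ (x :+ (X :+ x) :* ε) :* (X :+ x) :+ T)
           refl (φ (re x) * (re x * re x)) (φ (Tr x)) (frob e x) x ε ⟩
    Γ′ x ∎
    where
    1*≈ : ∀ y → X 0F * y ≈ y
    1*≈ y = trans (*-congʳ z≈1) (*-identityˡ y)
    u≈ : x ^ q + X 0F * x ≈ Tr x
    u≈ = +-congˡ (1*≈ x)

  -- Everything except the leading part of the first summand carries a factor z.
  Γ-value-infinite : ∀ X zz≈z → X 0F ≈ 0# → ∀ x → Γ-value X zz≈z x ≈ (frob e x * ε) ^ (σ e ℕ.+ 2)
  Γ-value-infinite X zz≈z z≈0 x =
    +0 (+0 (+0 (+0 (^-congˡ (σ e ℕ.+ 2) (trans (+-cong (0*≈ x) (*-congʳ (+0 refl))) (+-identityˡ _))))))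
    where
    0*≈ : ∀ y → X 0F * y ≈ 0#
    0*≈ y = trans (*-congʳ z≈0) (zeroˡ y)
    +0 : ∀ {a b y} → a ≈ b → a + X 0F * y ≈ b
    +0 a≈b = trans (+-cong a≈b (0*≈ _)) (+-identityʳ _)

  evalTo-affine : ∀ X → X 0F ≈ 1# → evalTo D equation X ≈ Tr (X 3F) + (Γ′ (X 1F) + Γ′ (X 2F))
  evalTo-affine X z≈1 = trans (proj₂ (value-equation X zz≈z)) (+-cong
    (+-cong (1*≈ _) (1*≈ _))
    (trans (-x≈x _) (+-cong (Γ-value-affine X zz≈z z≈1 (X 1F)) (trans (+-identityʳ _) (Γ-value-affine X zz≈z z≈1 (X 2F))))))
    where
    1*≈ : ∀ y → X 0F * y ≈ y
    1*≈ y = trans (*-congʳ z≈1) (*-identityˡ y)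
    zz≈z = 1*≈ (X 0F)

  evalTo-infinite : ∀ X → X 0F ≈ 0# →
    evalTo D equation X ≈ (frob e (X 1F) * ε) ^ (σ e ℕ.+ 2) + (frob e (X 2F) * ε) ^ (σ e ℕ.+ 2)
  evalTo-infinite X z≈0 = trans (proj₂ (value-equation X zz≈z)) (trans (+-cong
    (trans (+-cong (0*≈ _) (0*≈ _)) (+-identityʳ 0#))
    (trans (-x≈x _) (+-cong (Γ-value-infinite X zz≈z z≈0 (X 1F)) (trans (+-identityʳ _) (Γ-value-infinite X zz≈z z≈0 (X 2F))))))
    (+-identityˡ _))
    where
    0*≈ : ∀ y → X 0F * y ≈ 0#
    0*≈ y = trans (*-congʳ z≈0) (zeroˡ y)
    zz≈z = trans (0*≈ (X 0F)) (sym z≈0)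

  ε≉0 : ε ≉ 0#
  ε≉0 ε≈0 = 1≉0 (begin
    1#          ≈⟨ +-identityˡ 1# ⟨
    0# + 1#     ≈⟨ +-congʳ ε≈0 ⟨
    ε + 1#      ≈⟨ ε^q≈ε+1 ⟨
    frob e ε    ≈⟨ frob-cong e ε≈0 ⟩
    frob e 0#   ≈⟨ frob-zero e ⟩
    0#          ∎)

  bounded : Bounded D equation
  -- The bound does not depend on the point; the zero vector is one that satisfies z² = z.
  bounded = proj₁ (value-equation (λ _ → 0#) (zeroʳ 0#))

  -- At (0 : 1 : 0 : 0) only the leading form of the first Γ contributes, with the nonzero value
  -- ε^(σ+2).
  degree-equation : degree equation ≡ D
  degree-equation = degree-pure-power D equation bounded λ ≈0 → ε^≉0 (begin
    ε ^ (σ e ℕ.+ 2)                                                        ≈⟨ +-identityʳ _ ⟨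
    ε ^ (σ e ℕ.+ 2) + 0#
      ≈⟨ +-cong (^-congˡ (σ e ℕ.+ 2) (trans (*-congʳ (frob-one e)) (*-identityˡ ε))) 0^≈0 ⟨
    (frob e 1# * ε) ^ (σ e ℕ.+ 2) + (frob e 0# * ε) ^ (σ e ℕ.+ 2)          ≈⟨ evalTo-infinite e₁ refl ⟨
    evalTo D equation e₁                                                   ≈⟨ ≈0 ⟩
    0#                                                                     ∎)
    where
    ε^≉0 = ^≉0 (σ e ℕ.+ 2) ε≉0
    0^≈0 : (frob e 0# * ε) ^ (σ e ℕ.+ 2) ≈ 0#
    0^≈0 = trans (^[σ+2]≈ _) (trans (*-congˡ (trans (*-congʳ 0ε≈0) (zeroˡ _))) (zeroʳ _))
      where
      0ε≈0 : frob e 0# * ε ≈ 0#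
      0ε≈0 = trans (*-congʳ (frob-zero e)) (zeroˡ ε)

  evalTo-∈𝒱 : ∀ (X : Point 3) → evalTo D equation (proj₁ X) ≈ 0# → 𝒱 e ε X
  evalTo-∈𝒱 X = ≡.subst (λ d → evalTo d equation (proj₁ X) ≈ 0#) (≡.sym degree-equation)

  ∈𝒱-evalTo : ∀ (X : Point 3) → 𝒱 e ε X → evalTo D equation (proj₁ X) ≈ 0#
  ∈𝒱-evalTo X = ≡.subst (λ d → evalTo d equation (proj₁ X) ≈ 0#) degree-equation

  𝒱-resp-∼ : ∀ (X Y : Point 3) → X ∼ Y → 𝒱 e ε Y → 𝒱 e ε X
  𝒱-resp-∼ X Y (a , _ , X≈aY) Y∈𝒱 = evalTo-∈𝒱 X
    (trans (evalTo-scale a bounded X≈aY) (trans (*-congˡ (∈𝒱-evalTo Y Y∈𝒱)) (zeroʳ _)))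

  private
    frob-fixed : ∀ {z} → frob 2 z ≈ z → ∀ j → frob (j ℕ.+ j) z ≈ z
    frob-fixed {z} f2 zero    = frob-0 z
    frob-fixed {z} f2 (suc j) = begin
      frob (suc j ℕ.+ suc j) z     ≡⟨ ≡.cong (λ i → frob (suc i) z) (ℕ.+-suc j j) ⟩
      frob (2 ℕ.+ (j ℕ.+ j)) z     ≈⟨ frob-∘ 2 (j ℕ.+ j) z ⟨
      frob (j ℕ.+ j) (frob 2 z)    ≈⟨ frob-cong (j ℕ.+ j) f2 ⟩
      frob (j ℕ.+ j) z             ≈⟨ frob-fixed f2 j ⟩
      z                            ∎

  module _ (j : ℕ) (k≡j+j : k ≡ j ℕ.+ j) where

    -- gcd(2^k + 1, q² − 1) = 1 for even k: a root z of z^(2^k + 1) = 1 is fixed by frob (k + k),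
    -- hence by frob 2 because 2 e = 4 k + 2, hence by frob k; so z² = 1.
    root-trivial : ∀ {z} → frob k z * z ≈ 1# → z ≈ 1#
    root-trivial {z} ψzz≈1 = frob-injective 1 (begin
      frob 1 z        ≈⟨ frob-1 z ⟩
      z * z           ≈⟨ *-congʳ (trans (reflexive (≡.cong (λ i → frob i z) k≡j+j)) (frob-fixed frob-2 j)) ⟨
      frob k z * z    ≈⟨ ψzz≈1 ⟩
      1#              ≈⟨ frob-one 1 ⟨
      frob 1 1#       ∎)
      where
      ψz≉0 : frob k z ≉ 0#
      ψz≉0 ψz≈0 = 1≉0 (trans (sym ψzz≈1) (trans (*-congʳ ψz≈0) (zeroˡ z)))
      frob-2k : frob (k ℕ.+ k) z ≈ z
      frob-2k = *-cancelˡ-nonzero ψz≉0 (begin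
        frob k z * frob (k ℕ.+ k) z     ≈⟨ *-congˡ (frob-∘ k k z) ⟨
        frob k z * frob k (frob k z)    ≈⟨ *-comm _ _ ⟩
        frob k (frob k z) * frob k z    ≈⟨ frob-* k _ z ⟨
        frob k (frob k z * z)           ≈⟨ frob-cong k ψzz≈1 ⟩
        frob k 1#                       ≈⟨ frob-one k ⟩
        1#                              ≈⟨ ψzz≈1 ⟨
        frob k z * z                    ∎)
      frob-2 : frob 2 z ≈ z
      frob-2 = begin
        frob 2 z                                          ≈⟨ frob-cong 2 (trans (frob-cong (k ℕ.+ k) frob-2k) frob-2k) ⟨
        frob 2 (frob (k ℕ.+ k) (frob (k ℕ.+ k) z))        ≈⟨ frob-cong 2 (frob-∘ (k ℕ.+ k) (k ℕ.+ k) z) ⟩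
        frob 2 (frob (k ℕ.+ k ℕ.+ (k ℕ.+ k)) z)           ≈⟨ frob-∘ (k ℕ.+ k ℕ.+ (k ℕ.+ k)) 2 z ⟩
        frob (k ℕ.+ k ℕ.+ (k ℕ.+ k) ℕ.+ 2) z              ≡⟨ ≡.cong (λ i → frob i z) 4k+2≡2e ⟩
        frob (e ℕ.+ e) z                                  ≈⟨ frob-∘ e e z ⟨
        frob e (frob e z)                                 ≈⟨ frob-e-involutive z ⟩
        z                                                 ∎
        where
        4k+2≡2e : k ℕ.+ k ℕ.+ (k ℕ.+ k) ℕ.+ 2 ≡ e ℕ.+ e
        4k+2≡2e = ≡.trans (4k+2≡ k) (≡.cong₂ ℕ._+_ k+1+k≡e k+1+k≡e)

    -- Since σ = 2^(k+1), x^(σ+2) is the square of x^(2^k + 1), and squaring is injective. So for y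
    -- ≠ 0 the quotient x / y is a root of z^(2^k + 1) = 1.
    ^[σ+2]-injective : ∀ {x y} → x ^ (σ e ℕ.+ 2) ≈ y ^ (σ e ℕ.+ 2) → x ≈ y
    ^[σ+2]-injective {x} {y} eq with y ≟ 0#
    ... | yes y≈0 = trans (^≈0 (σ e ℕ.+ 2) (trans eq (trans (^-congˡ (σ e ℕ.+ 2) y≈0) 0^≈0))) (sym y≈0)
      where
      0^≈0 : 0# ^ (σ e ℕ.+ 2) ≈ 0#
      0^≈0 = trans (^[σ+2]≈ 0#) (trans (*-congˡ (zeroˡ 0#)) (zeroʳ _))
    ... | no y≉0 = begin
      x             ≈⟨ *-identityʳ x ⟨
      x * 1#        ≈⟨ *-congˡ yr≈1 ⟨
      x * (y * r)   ≈⟨ solve 3 (λ x y r → x :* (y :* r) := y :* (x :* r)) refl x y r ⟩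
      y * (x * r)   ≈⟨ *-congˡ (root-trivial xr-root) ⟩
      y * 1#        ≈⟨ *-identityʳ y ⟩
      y             ∎
      where
      r = proj₁ (inverse y y≉0)
      yr≈1 = proj₂ (inverse y y≉0)
      squares : ∀ x → frob 1 (frob k x * x) ≈ x ^ (σ e ℕ.+ 2)
      squares x = begin
        frob 1 (frob k x * x)               ≈⟨ frob-1 _ ⟩
        frob k x * x * (frob k x * x)       ≈⟨ solve 2 (λ X x → X :* x :* (X :* x) := X :* X :* (x :* x)) refl (frob k x) x ⟩
        frob k x * frob k x * (x * x)       ≈⟨ *-congʳ (frob-suc k x) ⟨
        φ x * (x * x)                       ≈⟨ ^[σ+2]≈ x ⟨
        x ^ (σ e ℕ.+ 2)                     ∎
      xr-root : frob k (x * r) * (x * r) ≈ 1#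
      xr-root = begin
        frob k (x * r) * (x * r)            ≈⟨ *-congʳ (frob-* k x r) ⟩
        frob k x * frob k r * (x * r)
          ≈⟨ solve 4 (λ X R x r → X :* R :* (x :* r) := X :* x :* (R :* r)) refl (frob k x) (frob k r) x r ⟩
        frob k x * x * (frob k r * r)
          ≈⟨ *-congʳ (frob-injective 1 (trans (squares x) (trans eq (sym (squares y))))) ⟩
        frob k y * y * (frob k r * r)
          ≈⟨ solve 4 (λ X R x r → X :* R :* (x :* r) := X :* x :* (R :* r)) refl (frob k y) (frob k r) y r ⟨
        frob k y * frob k r * (y * r)       ≈⟨ *-congʳ (frob-* k y r) ⟨
        frob k (y * r) * (y * r)            ≈⟨ *-cong (frob-cong k yr≈1) yr≈1 ⟩
        frob k 1# * 1#                      ≈⟨ *-identityʳ _ ⟩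
        frob k 1#                           ≈⟨ frob-one k ⟩
        1#                                  ∎

    infinite∈𝒱 : ∀ (X : Point 3) → proj₁ X 0F ≈ 0# → proj₁ X 1F ≈ proj₁ X 2F → 𝒱 e ε X
    infinite∈𝒱 X z≈0 x₁≈x₂ = evalTo-∈𝒱 X (trans (evalTo-infinite (proj₁ X) z≈0)
      (x≈y⇒x+y≈0 (^-congˡ (σ e ℕ.+ 2) (*-congʳ (frob-cong e x₁≈x₂)))))

    ∈𝒱-infinite : ∀ (X : Point 3) → proj₁ X 0F ≈ 0# → 𝒱 e ε X → proj₁ X 1F ≈ proj₁ X 2F
    ∈𝒱-infinite X z≈0 X∈𝒱 = frob-injective e (*-cancelˡ-nonzero ε≉0
      (trans (*-comm ε _) (trans (^[σ+2]-injective (x+y≈0⇒x≈y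
        (trans (sym (evalTo-infinite (proj₁ X) z≈0)) (∈𝒱-evalTo X X∈𝒱)))) (*-comm _ ε))))

  affine∈𝒱 : ∀ (X : Point 3) → proj₁ X 0F ≈ 1# →
             Tr (proj₁ X 3F) ≈ Γ′ (proj₁ X 1F) + Γ′ (proj₁ X 2F) → 𝒱 e ε X
  affine∈𝒱 X z≈1 eq = evalTo-∈𝒱 X (trans (evalTo-affine (proj₁ X) z≈1) (x≈y⇒x+y≈0 eq))

  ∈𝒱-affine : ∀ (X : Point 3) → proj₁ X 0F ≈ 1# → 𝒱 e ε X →
              Tr (proj₁ X 3F) ≈ Γ′ (proj₁ X 1F) + Γ′ (proj₁ X 2F)
  ∈𝒱-affine X z≈1 X∈𝒱 = x+y≈0⇒x≈y (trans (sym (evalTo-affine (proj₁ X) z≈1)) (∈𝒱-evalTo X X∈𝒱))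

-- Affine points, plus points other than (0 : 0 : 0 : 1) at infinity, plus 1 if (0 : 0 : 0 : 1) is on the plane.
data SectionSize (q : ℕ) : ℕ → Set where
  at-infinity       : SectionSize q (0 ℕ.+ (q ℕ.^ 2 ℕ.+ 1))
  cylinder-line     : SectionSize q (q ℕ.^ 2 ℕ.* q ℕ.+ (q ℕ.^ 2 ℕ.+ 1))
  cylinder-point    : SectionSize q (q ℕ.^ 2 ℕ.* q ℕ.+ (0 ℕ.+ 1))
  graph-special     : SectionSize q (1 ℕ.* 1 ℕ.+ (q ℕ.^ 2 ℕ.∸ 1) ℕ.* (q ℕ.+ 1) ℕ.+ (1 ℕ.+ 0))
  graph-ordinary    : SectionSize q ((q ℕ.+ 1) ℕ.* 1 ℕ.+ (q ℕ.^ 2 ℕ.∸ (q ℕ.+ 1)) ℕ.* (q ℕ.+ 1) ℕ.+ (1 ℕ.+ 0))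

-- Plane sections of 𝒱 and the weights as their complements.

module PlaneSections {c ℓ} (e k j : ℕ) (k+1+k≡e : k ℕ.+ suc k ≡ e) (k≡j+j : k ≡ j ℕ.+ j)
  (F : FiniteField c ℓ ((2 ℕ.^ e) ℕ.^ 2))
  (ε : FiniteField.Carrier F) (ε^q≈ε+1 : QuadraticExtension.EpsilonConjugate e F ε) where

  open FiniteField F hiding (zero) renaming (_≟_ to infix 4 _≟_)
  open FiniteFieldProperties F
  open QuadraticExtension e F
  open SuzukiOvoid e k k+1+k≡e F ε
  open OvoidSections e k k+1+k≡e F ε ε^q≈ε+1
  open Coordinates ε ε^q≈ε+1
  open Variety e k k+1+k≡e F ε ε^q≈ε+1
  open OverField F
  open RawSemiringDefs (Semiring.rawSemiring semiring) using (sum)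
  open 𝔽₂-Solver using (solve; _:+_; _:*_; _:=_; con)

  private
    cancel-inverse : ∀ {a b} → a * b ≈ 1# → ∀ x → x ≈ a * (b * x)
    cancel-inverse {a} {b} ab≈1 x = sym (trans (sym (*-assoc a b x)) (trans (*-congʳ ab≈1) (*-identityˡ x)))

    *-inverse : ∀ {a b x y} → a * b ≈ 1# → x ≈ a * y → y ≈ b * x
    *-inverse {a} {b} {x} {y} ab≈1 x≈ay = trans (cancel-inverse (trans (*-comm b a) ab≈1) y) (*-congˡ (sym x≈ay))

    inverse≉0 : ∀ {a b} → a * b ≈ 1# → b ≉ 0#
    inverse≉0 ab≈1 b≈0 = 1≉0 (trans (sym ab≈1) (trans (*-congˡ b≈0) (zeroʳ _)))

  ∼-sym : ∀ (X Y : Point 3) → X ∼ Y → Y ∼ X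
  ∼-sym X Y (a , a≉0 , X≈aY) = let b , ab≈1 = inverse a a≉0 in b , inverse≉0 ab≈1 , λ i → *-inverse ab≈1 (X≈aY i)

  PG³ : Setoid (c ⊔ ℓ) (c ⊔ ℓ)
  PG³ = record
    { Carrier       = Point 3
    ; _≈_           = _∼_
    ; isEquivalence = record
      { refl  = 1# , 1≉0 , λ _ → sym (*-identityˡ _)
      ; sym   = λ {X} {Y} → ∼-sym X Y
      ; trans = λ (a , a≉0 , X≈aY) (b , b≉0 , Y≈bZ) →
          a * b , *≉0 a≉0 b≉0 , λ i → trans (X≈aY i) (trans (*-congˡ (Y≈bZ i)) (sym (*-assoc a b _)))
      }
    }

  module _ (a : Vector Carrier 4) where

    tuple : (x₀ x₁ x₂ x₃ : Carrier) → Vector Carrier 4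
    tuple x₀ x₁ x₂ x₃ 0F = x₀
    tuple x₀ x₁ x₂ x₃ 1F = x₁
    tuple x₀ x₁ x₂ x₃ 2F = x₂
    tuple x₀ x₁ x₂ x₃ 3F = x₃

    form : Vector Carrier 4 → Carrier
    form X = sum (λ i → a i * X i)

    form-scale : ∀ {X Y} b → (∀ i → X i ≈ b * Y i) → form X ≈ b * form Y
    form-scale {X} {Y} b X≈bY = trans
      (+-cong (*-congˡ (X≈bY 0F)) (+-cong (*-congˡ (X≈bY 1F)) (+-cong (*-congˡ (X≈bY 2F)) (+-congʳ (*-congˡ (X≈bY 3F))))))
      (solve 9 (λ b a₀ a₁ a₂ a₃ y₀ y₁ y₂ y₃ →
         a₀ :* (b :* y₀) :+ (a₁ :* (b :* y₁) :+ (a₂ :* (b :* y₂) :+ (a₃ :* (b :* y₃) :+ con false)))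
         := b :* (a₀ :* y₀ :+ (a₁ :* y₁ :+ (a₂ :* y₂ :+ (a₃ :* y₃ :+ con false)))))
         refl b (a 0F) (a 1F) (a 2F) (a 3F) (Y 0F) (Y 1F) (Y 2F) (Y 3F))

    Section : Pred (Point 3) ℓ
    Section X = 𝒱 e ε X × form (proj₁ X) ≈ 0#

    section-resp : ∀ X Y → X ∼ Y → Section X → Section Y
    section-resp X Y X∼Y@(b , b≉0 , X≈bY) (X∈𝒱 , X∈H) = 𝒱-resp-∼ Y X (∼-sym X Y X∼Y) X∈𝒱 ,
      *≈0 b≉0 (trans (sym (form-scale b X≈bY)) X∈H)

    affine : (Carrier × Carrier) × Carrier → Point 3
    affine ((x₁ , x₂) , x₃) = tuple 1# x₁ x₂ x₃ , 0F , 1≉0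

    infinite : Carrier → Point 3
    infinite b = tuple 0# 1# 1# b , 1F , 1≉0

    vertex : Point 3
    vertex = tuple 0# 0# 0# 1# , 3F , 1≉0

    F³ = ×-setoid F² setoid

    ⊤-setoid = ≡.setoid ⊤

    AffineSection : Pred ((Carrier × Carrier) × Carrier) ℓ
    AffineSection x@((x₁ , x₂) , x₃) = Tr x₃ ≈ Γ′ x₁ + Γ′ x₂ × form (proj₁ (affine x)) ≈ 0#

    -- Affine points, points (0 : 1 : 1 : b) and the vertex (0 : 0 : 0 : 1) all have unique
    -- normalised representatives. The vertex is counted over `⊤`, so that its incidence with the
    -- plane is again a size, 0 or 1.
    section-size : ∀ {n₁ n₂ n₃} → HasSize F³ AffineSection n₁ →
                   HasSize setoid (λ b → form (proj₁ (infinite b)) ≈ 0#) n₂ →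
                   HasSize ⊤-setoid (λ _ → form (proj₁ vertex) ≈ 0#) n₃ →
                   HasSize PG³ Section (n₁ ℕ.+ (n₂ ℕ.+ n₃))
    section-size N₁ N₂ N₃ = hasSize-⇔ PG³ to from
      (hasSize-∪ PG³ disjoint₁ (hasSize-image F³ PG³ affine affine-cong affine-injective N₁)
        (hasSize-∪ PG³ disjoint₂
          (hasSize-image setoid PG³ infinite infinite-cong infinite-injective N₂)
          (hasSize-image ⊤-setoid PG³ (λ _ → vertex) (λ _ → PG.refl {vertex}) (λ _ _ _ → ≡.refl) N₃)))
      where
      module PG = Setoid PG³
      1*-cong : ∀ {X Y : Vector Carrier 4} → (∀ i → X i ≈ Y i) → ∃ λ b → b ≉ 0# × (∀ i → X i ≈ b * Y i)
      1*-cong X≈Y = 1# , 1≉0 , λ i → trans (X≈Y i) (sym (*-identityˡ _))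
      scalar≈1 : ∀ {b} → 1# ≈ b * 1# → ∀ {x y} → x ≈ b * y → x ≈ y
      scalar≈1 1≈b1 x≈by = trans x≈by (trans (*-congʳ (sym (trans 1≈b1 (*-identityʳ _)))) (*-identityˡ _))
      1≉*0 : ∀ {b} → ¬ 1# ≈ b * 0#
      1≉*0 1≈b0 = 1≉0 (trans 1≈b0 (zeroʳ _))
      affine-cong : ∀ {x y} → Setoid._≈_ F³ x y → affine x ∼ affine y
      affine-cong ((x₁≈ , x₂≈) , x₃≈) = 1*-cong λ { 0F → refl ; 1F → x₁≈ ; 2F → x₂≈ ; 3F → x₃≈ }
      affine-injective : ∀ x y → affine x ∼ affine y → Setoid._≈_ F³ x y
      affine-injective _ _ (b , _ , ≈b) = (scalar≈1 (≈b 0F) (≈b 1F) , scalar≈1 (≈b 0F) (≈b 2F)) , scalar≈1 (≈b 0F) (≈b 3F)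
      infinite-cong : ∀ {x y} → x ≈ y → infinite x ∼ infinite y
      infinite-cong x≈y = 1*-cong λ { 0F → refl ; 1F → refl ; 2F → refl ; 3F → x≈y }
      infinite-injective : ∀ x y → infinite x ∼ infinite y → x ≈ y
      infinite-injective _ _ (b , _ , ≈b) = scalar≈1 (≈b 1F) (≈b 3F)
      disjoint₁ : ∀ X Y → _ → _ → ¬ X ∼ Y
      disjoint₁ X Y (x , _ , X∼x) (inj₁ (y , _ , Y∼y)) X∼Y =
        let b , _ , ≈b = PG.trans {affine x} {X} {infinite y} (PG.sym {X} {affine x} X∼x) (PG.trans {X} {Y} {infinite y} X∼Y Y∼y)
        in 1≉*0 (≈b 0F)
      disjoint₁ X Y (x , _ , X∼x) (inj₂ (_ , _ , Y∼y)) X∼Y =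
        let b , _ , ≈b = PG.trans {affine x} {X} {vertex} (PG.sym {X} {affine x} X∼x) (PG.trans {X} {Y} {vertex} X∼Y Y∼y)
        in 1≉*0 (≈b 0F)
      disjoint₂ : ∀ X Y → _ → _ → ¬ X ∼ Y
      disjoint₂ X Y (x , _ , X∼x) (_ , _ , Y∼y) X∼Y =
        let b , _ , ≈b = PG.trans {infinite x} {X} {vertex} (PG.sym {X} {infinite x} X∼x) (PG.trans {X} {Y} {vertex} X∼Y Y∼y)
        in 1≉*0 (≈b 1F)
      to : ∀ X → _ → Section X
      to X (inj₁ (x , (Tr≈ , x∈H) , X∼x)) = section-resp (affine x) X (PG.sym {X} {affine x} X∼x)
        (affine∈𝒱 (affine x) refl Tr≈ , x∈H)
      to X (inj₂ (inj₁ (b , b∈H , X∼b))) = section-resp (infinite b) X (PG.sym {X} {infinite b} X∼b)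
        (infinite∈𝒱 j k≡j+j (infinite b) refl refl , b∈H)
      to X (inj₂ (inj₂ (_ , v∈H , X∼v))) = section-resp vertex X (PG.sym {X} {vertex} X∼v)
        (infinite∈𝒱 j k≡j+j vertex refl refl , v∈H)
      module _ (X : Point 3) (X∈S : Section X) where
        private
          x = proj₁ X
          x₁≈x₂ : x 0F ≈ 0# → x 1F ≈ x 2F
          x₁≈x₂ x₀≈0 = ∈𝒱-infinite j k≡j+j X x₀≈0 (proj₁ X∈S)
        affine-point : x 0F ≉ 0# → ∃ λ y → AffineSection y × X ∼ affine y
        affine-point x₀≉0 = y , (∈𝒱-affine (affine y) refl (proj₁ y∈S) , proj₂ y∈S) , X∼y
          where
          r = proj₁ (inverse (x 0F) x₀≉0)
          x₀r≈1 = proj₂ (inverse (x 0F) x₀≉0)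
          y = (r * x 1F , r * x 2F) , r * x 3F
          X∼y : X ∼ affine y
          X∼y = x 0F , x₀≉0 , λ { 0F → sym (*-identityʳ _) ; 1F → cancel-inverse x₀r≈1 _
                                ; 2F → cancel-inverse x₀r≈1 _ ; 3F → cancel-inverse x₀r≈1 _ }
          y∈S = section-resp X (affine y) X∼y X∈S
        infinite-point : x 0F ≈ 0# → x 1F ≉ 0# → ∃ λ b → form (proj₁ (infinite b)) ≈ 0# × X ∼ infinite b
        infinite-point x₀≈0 x₁≉0 = b , proj₂ (section-resp X (infinite b) X∼b X∈S) , X∼b
          where
          r = proj₁ (inverse (x 1F) x₁≉0)
          x₁r≈1 = proj₂ (inverse (x 1F) x₁≉0)
          b = r * x 3F
          X∼b : X ∼ infinite b
          X∼b = x 1F , x₁≉0 , λ { 0F → trans x₀≈0 (sym (zeroʳ _)) ; 1F → sym (*-identityʳ _)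
                                ; 2F → trans (sym (x₁≈x₂ x₀≈0)) (sym (*-identityʳ _)) ; 3F → cancel-inverse x₁r≈1 _ }
        vertex-point : x 0F ≈ 0# → x 1F ≈ 0# → ∃ λ (_ : ⊤) → form (proj₁ vertex) ≈ 0# × X ∼ vertex
        vertex-point x₀≈0 x₁≈0 = tt , proj₂ (section-resp X vertex X∼v X∈S) , X∼v
          where
          x₂≈0 : x 2F ≈ 0#
          x₂≈0 = trans (sym (x₁≈x₂ x₀≈0)) x₁≈0
          -- The nonzero coordinate that every point carries can only be the last one.
          x₃≉0 : ∀ i → x i ≉ 0# → x 3F ≉ 0#
          x₃≉0 0F ≉0 = ⊥-elim (≉0 x₀≈0)
          x₃≉0 1F ≉0 = ⊥-elim (≉0 x₁≈0)
          x₃≉0 2F ≉0 = ⊥-elim (≉0 x₂≈0)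
          x₃≉0 3F ≉0 = ≉0
          X∼v : X ∼ vertex
          X∼v = x 3F , x₃≉0 (proj₁ (proj₂ X)) (proj₂ (proj₂ X)) ,
            λ { 0F → trans x₀≈0 (sym (zeroʳ _)) ; 1F → trans x₁≈0 (sym (zeroʳ _))
              ; 2F → trans x₂≈0 (sym (zeroʳ _)) ; 3F → sym (*-identityʳ _) }
        classify : Dec (x 0F ≈ 0#) → Dec (x 1F ≈ 0#) → _
        classify (no x₀≉0)  _          = inj₁ (affine-point x₀≉0)
        classify (yes x₀≈0) (no x₁≉0)  = inj₂ (inj₁ (infinite-point x₀≈0 x₁≉0))
        classify (yes x₀≈0) (yes x₁≈0) = inj₂ (inj₂ (vertex-point x₀≈0 x₁≈0))
      from : ∀ X → Section X → _
      from X X∈S = classify X X∈S (proj₁ X 0F ≟ 0#) (proj₁ X 1F ≟ 0#)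

    private
      a₀ = a 0F
      a₁ = a 1F
      a₂ = a 2F
      a₃ = a 3F

    form-affine : ∀ x₁ x₂ x₃ → form (proj₁ (affine ((x₁ , x₂) , x₃))) ≈ a₀ + a₁ * x₁ + a₂ * x₂ + a₃ * x₃
    form-affine = solve 7 (λ a b c d x y z → a :* con true :+ (b :* x :+ (c :* y :+ (d :* z :+ con false)))
      := a :+ b :* x :+ c :* y :+ d :* z) refl a₀ a₁ a₂ a₃

    form-infinite : ∀ b → form (proj₁ (infinite b)) ≈ a₁ + a₂ + a₃ * b
    form-infinite = solve 5 (λ a b c d z → a :* con false :+ (b :* con true :+ (c :* con true :+ (d :* z :+ con false)))
      := b :+ c :+ d :* z) refl a₀ a₁ a₂ a₃

    form-vertex : form (proj₁ vertex) ≈ a₃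
    form-vertex = solve 4 (λ a b c d → a :* con false :+ (b :* con false :+ (c :* con false :+ (d :* con true :+ con false)))
      := d) refl a₀ a₁ a₂ a₃

    SectionHasSize : Set _
    SectionHasSize = ∃ λ n → SectionSize q n × HasSize PG³ Section n

    -- The plane is the graph of `height`, an affine function of x₁ and x₂. Substituting it for x₃
    -- and applying Tr distributes its linear part over the two copies of Γ′. What remains is g₁ x₁
    -- + g₂ x₂ = Tr (a₀ / a₃) with two ovoidal functions.
    graph-section : a₃ ≉ 0# → SectionHasSize
    graph-section a₃≉0 = case ovoidal-sum-size (ovoidal-+linear (r * a₁)) (ovoidal-+linear (r * a₂)) (Tr∈K (r * a₀)) of λ
      { (inj₁ N) → _ , graph-special , section-size (affine-section N) infinite-section vertex-section
      ; (inj₂ N) → _ , graph-ordinary , section-size (affine-section N) infinite-section vertex-section }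
      where
      r = proj₁ (inverse a₃ a₃≉0)
      a₃r≈1 = proj₂ (inverse a₃ a₃≉0)
      g₁ = λ x → Tr (r * a₁ * x) + Γ′ x
      g₂ = λ x → Tr (r * a₂ * x) + Γ′ x
      height : Carrier → Carrier → Carrier
      height x y = r * a₀ + r * a₁ * x + r * a₂ * y
      height≈ : ∀ x y → height x y ≈ r * (a₀ + a₁ * x + a₂ * y)
      height≈ = solve 6 (λ r a b c x y → r :* a :+ r :* b :* x :+ r :* c :* y := r :* (a :+ b :* x :+ c :* y)) refl r a₀ a₁ a₂
      Tr-height : ∀ x y → Tr (height x y) + (Γ′ x + Γ′ y) ≈ Tr (r * a₀) + (g₁ x + g₂ y)
      Tr-height x y = trans (+-congʳ (trans (Tr-+ _ _) (+-congʳ (Tr-+ _ _))))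
        (solve 5 (λ a b c f g → a :+ b :+ c :+ (f :+ g) := a :+ (b :+ f :+ (c :+ g))) refl (Tr (r * a₀)) _ _ (Γ′ x) (Γ′ y))
      affine-section : ∀ {n} → HasSize F² (λ (x , y) → g₁ x + g₂ y ≈ Tr (r * a₀)) n → HasSize F³ AffineSection n
      affine-section = hasSize-map F² F³ (λ (x , y) → (x , y) , height x y)
        (λ (x≈ , y≈) → (x≈ , y≈) , +-cong (+-congˡ (*-congˡ x≈)) (*-congˡ y≈))
        (λ (x , y) g≈ → x+y≈0⇒x≈y (trans (Tr-height x y) (x≈y⇒x+y≈0 (sym g≈))) ,
           trans (form-affine x y _) (x≈y⇒x+y≈0 (trans (cancel-inverse a₃r≈1 _) (*-congˡ (sym (height≈ x y))))))
        (λ _ _ _ _ (xy≈ , _) → xy≈)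
        (λ ((x , y) , z) (Trz≈ , ∈H) →
           let z≈ : z ≈ height x y
               z≈ = trans (*-inverse a₃r≈1 (x+y≈0⇒x≈y (trans (sym (form-affine x y z)) ∈H))) (sym (height≈ x y))
           in (x , y) ,
              sym (x+y≈0⇒x≈y (trans (sym (Tr-height x y)) (x≈y⇒x+y≈0 (trans (Tr-cong (sym z≈)) Trz≈)))) ,
              ((refl , refl) , z≈))
      infinite-section : HasSize setoid (λ b → form (proj₁ (infinite b)) ≈ 0#) 1
      infinite-section = hasSize-1 setoid (r * (a₁ + a₂))
        (trans (form-infinite _) (x≈y⇒x+y≈0 (cancel-inverse a₃r≈1 _)))
        (λ b ∈H → *-inverse a₃r≈1 (x+y≈0⇒x≈y (trans (sym (form-infinite b)) ∈H)))
      vertex-section : HasSize ⊤-setoid (λ _ → form (proj₁ vertex) ≈ 0#) 0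
      vertex-section = hasSize-∅ ⊤-setoid λ _ ∈H → a₃≉0 (trans (sym form-vertex) ∈H)

    module _ (a₃≈0 : a₃ ≈ 0#) where

      vertex∈ : HasSize ⊤-setoid (λ _ → form (proj₁ vertex) ≈ 0#) 1
      vertex∈ = hasSize-1 ⊤-setoid tt (trans form-vertex a₃≈0) (λ _ _ → ≡.refl)

      -- The form is constant on the points (0 : 1 : 1 : b), so the line of 𝒱 at infinity either
      -- lies in the plane or meets it only in the vertex.
      form-infinite-cylinder : ∀ b → form (proj₁ (infinite b)) ≈ a₁ + a₂
      form-infinite-cylinder b = trans (form-infinite b) (trans (+-congˡ (trans (*-congʳ a₃≈0) (zeroˡ b))) (+-identityʳ _))

      infinite-all : a₁ + a₂ ≈ 0# → HasSize setoid (λ b → form (proj₁ (infinite b)) ≈ 0#) (q ℕ.^ 2)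
      infinite-all a₁+a₂≈0 = hasSize-⇔ setoid (λ b _ → trans (form-infinite-cylinder b) a₁+a₂≈0) _ size

      infinite-none : a₁ + a₂ ≉ 0# → HasSize setoid (λ b → form (proj₁ (infinite b)) ≈ 0#) 0
      infinite-none a₁+a₂≉0 = hasSize-∅ setoid λ b ∈H → a₁+a₂≉0 (trans (sym (form-infinite-cylinder b)) ∈H)

      -- The plane does not restrict x₃. Above each base point (x₁, x₂) the points of 𝒱 therefore
      -- form a full fibre of Tr over an element of K, with q elements.
      affine-cylinder : ∀ {n} → HasSize F² (λ (x , y) → a₀ + a₁ * x + a₂ * y ≈ 0#) n → HasSize F³ AffineSection (n ℕ.* q)
      affine-cylinder N = hasSize-⇔ F³
        (λ ((x , y) , z) (∈L , Trz≈) → Trz≈ , trans (form-cylinder x y z) ∈L)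
        (λ ((x , y) , z) (Trz≈ , ∈H) → trans (sym (form-cylinder x y z)) ∈H , Trz≈)
        (hasSize-Σ F² setoid
          (λ { _ (x≈ , y≈) Tr≈ → trans Tr≈ (+-cong (Γ′-cong x≈) (Γ′-cong y≈)) })
          N (λ (x , y) _ → Tr-fibre-size (+∈K (suzuki∈K (re∈K x) (Tr∈K x)) (suzuki∈K (re∈K y) (Tr∈K y)))))
        where
        Γ′-cong : ∀ {x y} → x ≈ y → Γ′ x ≈ Γ′ y
        Γ′-cong x≈y = suzuki-cong (re-cong x≈y) (Tr-cong x≈y)
        form-cylinder : ∀ x y z → form (proj₁ (affine ((x , y) , z))) ≈ a₀ + a₁ * x + a₂ * y
        form-cylinder x y z = trans (form-affine x y z) (trans (+-congˡ (trans (*-congʳ a₃≈0) (zeroˡ z))) (+-identityʳ _))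

      cylinder-section : HasSize F² (λ (x , y) → a₀ + a₁ * x + a₂ * y ≈ 0#) (q ℕ.^ 2) → SectionHasSize
      cylinder-section N = case a₁ + a₂ ≟ 0# of λ
        { (yes a₁+a₂≈0) → _ , cylinder-line , section-size (affine-cylinder N) (infinite-all a₁+a₂≈0) vertex∈
        ; (no a₁+a₂≉0)  → _ , cylinder-point , section-size (affine-cylinder N) (infinite-none a₁+a₂≉0) vertex∈ }

      line-size₁ : a₁ ≉ 0# → HasSize F² (λ (x , y) → a₀ + a₁ * x + a₂ * y ≈ 0#) (q ℕ.^ 2)
      line-size₁ a₁≉0 = hasSize-map setoid F² (λ y → r * (a₀ + a₂ * y) , y)
        (λ y≈ → *-congˡ (+-congˡ (*-congˡ y≈)) , y≈)
        (λ y _ → trans (swap _ y) (x≈y⇒x+y≈0 (cancel-inverse a₁r≈1 _)))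
        (λ _ _ _ _ → proj₂)
        (λ (x , y) ∈L → y , _ , *-inverse a₁r≈1 (x+y≈0⇒x≈y (trans (sym (swap x y)) ∈L)) , refl)
        size
        where
        r = proj₁ (inverse a₁ a₁≉0)
        a₁r≈1 = proj₂ (inverse a₁ a₁≉0)
        swap : ∀ x y → a₀ + a₁ * x + a₂ * y ≈ a₀ + a₂ * y + a₁ * x
        swap = solve 5 (λ a b c x y → a :+ b :* x :+ c :* y := a :+ c :* y :+ b :* x) refl a₀ a₁ a₂

      line-size₂ : a₂ ≉ 0# → HasSize F² (λ (x , y) → a₀ + a₁ * x + a₂ * y ≈ 0#) (q ℕ.^ 2)
      line-size₂ a₂≉0 = hasSize-map setoid F² (λ x → x , r * (a₀ + a₁ * x))
        (λ x≈ → x≈ , *-congˡ (+-congˡ (*-congˡ x≈)))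
        (λ x _ → x≈y⇒x+y≈0 (cancel-inverse a₂r≈1 _))
        (λ _ _ _ _ → proj₁)
        (λ (x , y) ∈L → x , _ , refl , *-inverse a₂r≈1 (x+y≈0⇒x≈y ∈L))
        size
        where
        r = proj₁ (inverse a₂ a₂≉0)
        a₂r≈1 = proj₂ (inverse a₂ a₂≉0)

      module _ (a₁≈0 : a₁ ≈ 0#) (a₂≈0 : a₂ ≈ 0#) where

        constant : ∀ x y → a₀ + a₁ * x + a₂ * y ≈ a₀
        constant x y = trans (+-cong (+-congˡ (trans (*-congʳ a₁≈0) (zeroˡ x))) (trans (*-congʳ a₂≈0) (zeroˡ y)))
          (trans (+-identityʳ _) (+-identityʳ _))

        a₁+a₂≈0 : a₁ + a₂ ≈ 0#
        a₁+a₂≈0 = x≈y⇒x+y≈0 (trans a₁≈0 (sym a₂≈0))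

        infinite-plane-section : a₀ ≉ 0# → SectionHasSize
        infinite-plane-section a₀≉0 = _ , at-infinity , section-size
          (affine-cylinder (hasSize-∅ F² λ (x , y) ∈L → a₀≉0 (trans (sym (constant x y)) ∈L))) (infinite-all a₁+a₂≈0) vertex∈

        -- The zero form imposes no condition, so the same count also yields the number of points of
        -- 𝒱.
        whole-section : a₀ ≈ 0# → HasSize PG³ Section (q ℕ.^ 2 ℕ.* q ℕ.^ 2 ℕ.* q ℕ.+ (q ℕ.^ 2 ℕ.+ 1))
        whole-section a₀≈0 = section-size
          (affine-cylinder (hasSize-⇔ F² (λ (x , y) _ → trans (constant x y) a₀≈0) _
            (hasSize-Σ setoid setoid {Ω = U} {Ψ = λ _ → U} _ size (λ _ _ → size))))
          (infinite-all a₁+a₂≈0) vertex∈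

    plane-section : ¬ (∀ i → a i ≈ 0#) → SectionHasSize
    plane-section a≉0 = by-cases (a₃ ≟ 0#) (a₁ ≟ 0#) (a₂ ≟ 0#) (a₀ ≟ 0#)
      where
      by-cases : Dec (a₃ ≈ 0#) → Dec (a₁ ≈ 0#) → Dec (a₂ ≈ 0#) → Dec (a₀ ≈ 0#) → SectionHasSize
      by-cases (no a₃≉0)  _          _          _          = graph-section a₃≉0
      by-cases (yes a₃≈0) (no a₁≉0)  _          _          = cylinder-section a₃≈0 (line-size₁ a₃≈0 a₁≉0)
      by-cases (yes a₃≈0) (yes _)    (no a₂≉0)  _          = cylinder-section a₃≈0 (line-size₂ a₃≈0 a₂≉0)
      by-cases (yes a₃≈0) (yes a₁≈0) (yes a₂≈0) (no a₀≉0)  = infinite-plane-section a₃≈0 a₁≈0 a₂≈0 a₀≉0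
      by-cases (yes a₃≈0) (yes a₁≈0) (yes a₂≈0) (yes a₀≈0) =
        ⊥-elim (a≉0 λ { 0F → a₀≈0 ; 1F → a₁≈0 ; 2F → a₂≈0 ; 3F → a₃≈0 })

  𝒱-size : HasSize PG³ (𝒱 e ε) (q ℕ.^ 2 ℕ.* q ℕ.^ 2 ℕ.* q ℕ.+ (q ℕ.^ 2 ℕ.+ 1))
  𝒱-size = hasSize-⇔ PG³ (λ _ → proj₁)
    (λ (x , _) X∈𝒱 → X∈𝒱 , solve 4 (λ x y z w → con false :* x :+ (con false :* y :+ (con false :* z :+ (con false :* w :+ con false))) := con false)
       refl (x 0F) (x 1F) (x 2F) (x 3F))
    (whole-section (λ _ → 0#) refl refl refl refl)

  -- Words of the code are evaluations of linear forms, so zeros are the points of a plane section.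
  weight-complement : ∀ {N} {P : Fin N → Point 3} → Enumerates P (𝒱 e ε) → ∀ w → 𝒞 P w → NonZeroWord w →
    ∃ λ n → SectionSize q n × weight w ≡ (q ℕ.^ 2 ℕ.* q ℕ.^ 2 ℕ.* q ℕ.+ (q ℕ.^ 2 ℕ.+ 1)) ℕ.∸ n
  weight-complement {N} {P} enumerates w (a , w≈) w≉0 = n , n-size , 
    ≡.trans (hasSize-unique Fin-N (hasSize-count λ i → ¬? (w i ≟ 0#)) nonzeros)
      (≡.cong (ℕ._∸ n) (hasSize-unique PG³ points 𝒱-size))
    where
    open Enumerates enumerates
    Fin-N = ≡.setoid (Fin N)
    a≉0 : ¬ (∀ i → a i ≈ 0#)
    a≉0 a≈0 = w≉0 λ i → trans (w≈ i) (trans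
      (+-cong (*-congʳ (a≈0 0F)) (+-cong (*-congʳ (a≈0 1F)) (+-cong (*-congʳ (a≈0 2F)) (+-congʳ (*-congʳ (a≈0 3F))))))
      (solve 4 (λ x y z w → con false :* x :+ (con false :* y :+ (con false :* z :+ (con false :* w :+ con false))) := con false)
       refl (proj₁ (P i) 0F) (proj₁ (P i) 1F) (proj₁ (P i) 2F) (proj₁ (P i) 3F)))
    n = proj₁ (plane-section a a≉0)
    n-size = proj₁ (proj₂ (plane-section a a≉0))
    section = proj₂ (proj₂ (plane-section a a≉0))
    points : HasSize PG³ (𝒱 e ε) N
    points = record { elem = P ; sound = sound ; distinct = distinct ; complete = complete }
    zero? : ∀ i → Dec (w i ≈ 0#)
    zero? i = w i ≟ 0#
    zeros : HasSize PG³ (Section a) (Vec.count zero? (Vec.allFin N))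
    zeros = hasSize-map Fin-N PG³ P (λ { {i} ≡.refl → Setoid.refl PG³ {P i} })
      (λ i wᵢ≈0 → sound i , trans (sym (w≈ i)) wᵢ≈0)
      (λ i j _ _ → distinct i j)
      (λ X X∈S → let i , X∼Pᵢ = complete X (proj₁ X∈S) in
         i , trans (w≈ i) (proj₂ (section-resp a X (P i) X∼Pᵢ X∈S)) , X∼Pᵢ)
      (hasSize-count zero?)
    all : HasSize Fin-N U N
    all = record { elem = λ i → i ; sound = _ ; distinct = λ _ _ eq → eq ; complete = λ i _ → i , ≡.refl }
    nonzeros : HasSize Fin-N (λ i → ¬ w i ≈ 0#) (N ℕ.∸ n)
    nonzeros = hasSize-⇔ Fin-N (λ _ → proj₂) (λ _ → _ ,_)
      (hasSize-∖ Fin-N (λ { ≡.refl wᵢ≈0 → wᵢ≈0 }) zero? all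
        (hasSize-⇔ Fin-N (λ _ → _ ,_) (λ _ → proj₂)
          -- The zero positions of w and the geometric count enumerate the same section, so the
          -- number of zeros is n.
          (≡.subst (HasSize Fin-N _) (hasSize-unique PG³ zeros section) (hasSize-count zero?))))

-- Arithmetic of the five weights and the theorem.

open import Data.Nat using (_+_; _*_; _^_; _≤_; s≤s; z≤n; _%_; >-nonZero)
open import Data.Nat.Divisibility using (_∣_)

module _ where
  open ℕ.+-*-Solver using (solve; _:+_; _:*_; _:=_; con; Polynomial)

  private
    -- Shaped like the unfolding of `_^_`, so that the solved identities are definitionally about q
    -- ^ 2, q ^ 3 and q ^ 5.
    sq cube fifth total : ∀ {m} → Polynomial m → Polynomial m
    sq q = q :* (q :* con 1)
    cube q = q :* sq q
    fifth q = q :* (q :* cube q)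
    total q = sq q :* sq q :* q :+ (sq q :+ con 1)

    ∸-from-+ : ∀ {m n d} → m ≡ d + n → m ∸ n ≡ d
    ∸-from-+ {n = n} {d} ≡.refl = ℕ.m+n∸n≡m d n

    1+q≤q² : ∀ {q} → 2 ≤ q → q + 1 ≤ q ^ 2
    1+q≤q² {q} 2≤q = begin
      q + 1    ≤⟨ ℕ.+-monoʳ-≤ q (ℕ.≤-trans (ℕ.n≤1+n 1) 2≤q) ⟩
      q + q    ≡⟨ solve 1 (λ q → q :+ q := con 2 :* q) ≡.refl q ⟩
      2 * q    ≤⟨ ℕ.*-monoˡ-≤ q 2≤q ⟩
      q * q    ≡⟨ ≡.cong (q *_) (ℕ.*-identityʳ q) ⟨
      q ^ 2    ∎
      where open ℕ.≤-Reasoning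

  -- Each truncated difference is treated as a variable tied to its defining sum: d + q³ = q⁵, and b
  -- + 1 = q² or b + (q + 1) = q². The last of these needs q ≥ 2. Every case then becomes a
  -- polynomial identity without subtraction.
  complement∈weights : ∀ {q n} → 2 ≤ q → SectionSize q n →
    (q ^ 2 * q ^ 2 * q + (q ^ 2 + 1)) ∸ n ∈
      (q ^ 5 ∷ q ^ 5 ∸ q ^ 3 ∷ q ^ 5 ∸ q ^ 3 + q ^ 2 ∷ q ^ 5 ∸ q ^ 3 + q ∷ q ^ 5 ∸ q ^ 3 + q ^ 2 + q ∷ [])
  complement∈weights {q} 2≤q = λ
    { at-infinity    → here (∸-from-+ (solve 1 (λ q → total q := fifth q :+ (con 0 :+ (sq q :+ con 1))) ≡.refl q))
    ; cylinder-line  → there (here (∸-from-+ (≡.trans total≡ (solve 2 (λ d q →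
        d :+ cube q :+ (sq q :+ con 1) := d :+ (sq q :* q :+ (sq q :+ con 1))) ≡.refl d q))))
    ; cylinder-point → there (there (here (∸-from-+ (≡.trans total≡ (solve 2 (λ d q →
        d :+ cube q :+ (sq q :+ con 1) := d :+ sq q :+ (sq q :* q :+ (con 0 :+ con 1))) ≡.refl d q)))))
    ; graph-special  → there (there (there (here (∸-from-+ (≡.trans total≡′ (≡.trans
        (≡.cong (λ s → d + s * (q + 1) + 1) (≡.sym (ℕ.m∸n+n≡m 1≤q²)))
        (solve 3 (λ d q b → d :+ (b :+ con 1) :* (q :+ con 1) :+ con 1
          := d :+ q :+ (con 1 :* con 1 :+ b :* (q :+ con 1) :+ (con 1 :+ con 0))) ≡.refl d q (q ^ 2 ∸ 1))))))))
    ; graph-ordinary → there (there (there (there (here (∸-from-+ (≡.trans total≡′ (≡.trans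
        (≡.cong (λ s → d + s * (q + 1) + 1) q²≡)
        (solve 3 (λ d q b → d :+ (b :+ (q :+ con 1)) :* (q :+ con 1) :+ con 1
          := d :+ sq q :+ q :+ ((q :+ con 1) :* con 1 :+ b :* (q :+ con 1) :+ (con 1 :+ con 0))) ≡.refl d q (q ^ 2 ∸ (q + 1))))))))))
    }
    where
    d = q ^ 5 ∸ q ^ 3
    1≤q² = ℕ.≤-trans (ℕ.m≤n+m 1 q) (1+q≤q² 2≤q)
    q²≡ = ≡.sym (ℕ.m∸n+n≡m (1+q≤q² 2≤q))
    total≡ : q ^ 2 * q ^ 2 * q + (q ^ 2 + 1) ≡ d + q ^ 3 + (q ^ 2 + 1)
    total≡ = ≡.trans (solve 1 (λ q → total q := fifth q :+ (sq q :+ con 1)) ≡.refl q)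
      (≡.cong (_+ (q ^ 2 + 1)) (≡.sym (ℕ.m∸n+n≡m (ℕ.^-monoʳ-≤ q {{>-nonZero (ℕ.≤-trans (s≤s z≤n) 2≤q)}} (ℕ.m≤m+n 3 2)))))
    total≡′ : q ^ 2 * q ^ 2 * q + (q ^ 2 + 1) ≡ d + q ^ 2 * (q + 1) + 1
    total≡′ = ≡.trans total≡ (solve 2 (λ d q → d :+ cube q :+ (sq q :+ con 1) := d :+ sq q :* (q :+ con 1) :+ con 1) ≡.refl d q)

  -- For e = 4j + 1 the k with e = 2k + 1 is 2j; its evenness is what the injectivity of x ↦ x^(σ+2)
  -- on F uses.
  halves : ∀ {e} → e % 4 ≡ 1 → (e / 4 + e / 4) + suc (e / 4 + e / 4) ≡ e
  halves {e} e%4≡1 = ≡.sym (≡.trans (m≡m%n+[m/n]*n e 4) (≡.trans (≡.cong (_+ e / 4 * 4) e%4≡1)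
    (solve 1 (λ j → con 1 :+ j :* con 4 := j :+ j :+ (con 1 :+ (j :+ j))) ≡.refl (e / 4))))

theorem3p4 : ∀ {c ℓ} (e : ℕ) → 3 ≤ e → ¬ (2 ∣ e) → e % 4 ≡ 1 →
    let q = 2 ^ e in
    (F : FiniteField c ℓ (q ^ 2)) →
    let open FiniteField F using (Carrier)
        open OverField F in
    (ε δ : Carrier) → Admissible e ε δ →
    (N : ℕ) (P : Fin N → Point 3) → Enumerates P (𝒱 e ε) →
    (w : Vector Carrier N) → 𝒞 P w → NonZeroWord w →
    weight w ∈ (q ^ 5 ∷ q ^ 5 ∸ q ^ 3 ∷ q ^ 5 ∸ q ^ 3 + q ^ 2
                ∷ q ^ 5 ∸ q ^ 3 + q ∷ q ^ 5 ∸ q ^ 3 + q ^ 2 + q ∷ [])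
theorem3p4 e _ _ e%4≡1 F ε δ admissible N P enumerates w w∈𝒞 w≉0 =
  let n , s , weight≡ = weight-complement enumerates w w∈𝒞 w≉0
  in ≡.subst (_∈ _) (≡.sym weight≡) (complement∈weights 2≤q s)
  where
  open OverField.Admissible admissible using (trace-δ; root)
  open FiniteField F using (trans; +-congˡ)
  j = e / 4
  k = j + j
  ε^q≈ε+1 : QuadraticExtension.EpsilonConjugate e F ε
  -- At length e the partial sum of conjugates is the whole absolute trace of δ, which is 1.
  ε^q≈ε+1 = trans (QuadraticExtension.frob-root e F root e) (+-congˡ trace-δ)
  open PlaneSections e k j (halves e%4≡1) ≡.refl F ε ε^q≈ε+1
  open SuzukiOvoid e k (halves e%4≡1) F ε using (2≤q)
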